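{- Let $R$ be a ring (with multiplicative identity). There exists an algorithm that, given as input a finite set $U$ with $n$ elements and families $\mathcal{F}\subseteq 2^U$ and $\mathcal{G}\subseteq 2^U$, constructs, in time $O^*\bigl(|{\downarrow}\mathcal{F}|+|{\downarrow}\mathcal{G}|\bigr)$, an $R$-arithmetic circuit with input gates for the values $f(X)$, $X\in\mathcal{F}$, of an arbitrary function $f:\mathcal{F}\rightarrow R$, and with output gates, one for each pair $(j,Y)\in\{0,1,\ldots,n\}\times\mathcal{G}$, such that for every $f:\mathcal{F}\rightarrow R$ the output gate for $(j,Y)$ evaluates to $$f\iota_j(Y)=\sum_{\substack{X\in\mathcal{F}\\ |X\cap Y|=j}} f(X).$$
   Context: $2^U$ denotes the set of all subsets of $U$. For $\mathcal{F}\subseteq 2^U$, the down-closure ${\downarrow}\mathcal{F}$ is the family consisting of all the sets in $\mathcal{F}$ and all their subsets, i.e. ${\downarrow}\mathcal{F}=\{Z\subseteq U: Z\subseteq X\text{ for some }X\in\mathcal{F}\}$. The intersection transform of a function $f:2^U\to R$ is the function $f\iota:\{0,1,\ldots,n\}\times 2^U\to R$ given by $f\iota_j(Y)=\sum_{X\subseteq U,\ |X\cap Y|=j}f(X)$. A function $f$ defined only on $\mathcal{F}\subseteq 2^U$ is treated as zero outside $\mathcal{F}$, so that the sum ranges over $X\in\mathcal{F}$ with $|X\cap Y|=j$. An $R$-arithmetic circuit is a finite directed acyclic graph whose nodes (gates) are input gates, constant gates (integer constants embedded in $R$ via $z\mapsto z\cdot 1_R$), and gates computing sums, differences or products in $R$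 of previously computed gate values; some gates are designated as output gates. Since the circuit is constructed within the stated time, in particular it has $O^*\bigl(|{\downarrow}\mathcal{F}|+|{\downarrow}\mathcal{G}|\bigr)$ gates. The notation $O^*(\cdot)$ suppresses a factor polynomial in $n$: a quantity is $O^*(T)$ if it is at most $p(n)\cdot T$ for some fixed polynomial $p$. -}

module Defs where

open import Algebra.Bundles using (Ring)
import Algebra.Definitions.RawMonoid as RawMonoidDefs
open import Data.Bool.Base using (Bool; true; false)
open import Data.Fin.Base using (Fin; zero; suc; toℕ)
open import Data.Fin.Subset using (Subset; inside; outside; _∩_; ∣_∣)
open import Data.Fin.Subset.Properties using (_⊆?_)
open import Data.Integer.Base using (ℤ; +_; -[1+_])
open import Data.List.Base using (List; []; _∷_; _++_; map; foldr; filter; length; allFin; cartesianProduct)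
open import Data.List.Membership.Propositional using (_∈_; mapWith∈)
open import Data.List.Relation.Binary.Permutation.Propositional using (_↭_)
open import Data.List.Relation.Unary.All using (All)
open import Data.List.Relation.Unary.Any using (any?)
open import Data.List.Relation.Unary.Unique.Propositional using (Unique)
open import Data.Nat.Base using (ℕ; zero; suc; _+_; _*_; _⊔_; _≤_)
open import Data.Nat.Properties using (_≟_)
open import Data.Product.Base using (Σ; ∃; _×_; _,_; proj₁; proj₂)
open import Data.Vec.Base using (Vec; []; _∷_; _∷ʳ_; lookup; toList)
open import Level using (Level)

private
  variable
    n k m s : ℕ
    a b c ℓ : Level

-- A family of subsets of U = Fin n, given by a listing without repetitions (a `Unique`
-- hypothesis accompanies it wherever it is used), in any order.
Family : ℕ → Set
Family n = List (Subset n)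

-- f : ℱ → R is f : Member ℱ → R; as ℱ is listed without repetitions, each
-- X in ℱ has exactly one membership proof.
Member : Family n → Set
Member ℱ = ∃ (_∈ ℱ)

members : (ℱ : Family n) → List (Member ℱ)
members ℱ = mapWith∈ ℱ (λ {X} X∈ℱ → X , X∈ℱ)

allSubsets : (n : ℕ) → List (Subset n)
allSubsets zero    = [] ∷ []
allSubsets (suc n) = map (outside ∷_) (allSubsets n) ++ map (inside ∷_) (allSubsets n)

-- {Z ⊆ U : Z ⊆ X for some X ∈ ℱ}, without repetitions.
↓_ : Family n → Family n
↓_ {n} ℱ = filter (λ Z → any? (Z ⊆?_) ℱ) (allSubsets n)

-- A gate placed after s earlier gates, which it addresses by Fin s.
data Gate (I : Set a) (s : ℕ) : Set a where
  input       : I → Gate I s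
  const       : ℤ → Gate I s
  add sub mul : Fin s → Fin s → Gate I s

-- s gates in topological order; the gate appended to Gates I s has address s.
infixl 5 _▷_
data Gates (I : Set a) : ℕ → Set a where
  []  : Gates I 0
  _▷_ : Gates I s → Gate I s → Gates I (suc s)

inputLabels : {I : Set a} → Gates I s → List I
inputLabels []            = []
inputLabels (C ▷ input x) = x ∷ inputLabels C
inputLabels (C ▷ _)       = inputLabels C

record Circuit (I : Set a) (O : Set b) : Set (a Level.⊔ b) where
  field
    size    : ℕ
    gates   : Gates I size
    outputs : List (O × Fin size)

open Circuit public

module _ (R : Ring c ℓ) where
  open Ring R renaming (_+_ to _⊕_; _*_ to _⊛_)
  open RawMonoidDefs +-rawMonoid using () renaming (_×_ to _·_)

  fromℤ : ℤ → Carrier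
  fromℤ (+ i)    = i · 1#
  fromℤ -[1+ i ] = - (suc i · 1#)

  gateValue : {I : Set a} → (I → Carrier) → Vec Carrier s → Gate I s → Carrier
  gateValue f vs (input x) = f x
  gateValue f vs (const z) = fromℤ z
  gateValue f vs (add i j) = lookup vs i ⊕ lookup vs j
  gateValue f vs (sub i j) = lookup vs i - lookup vs j
  gateValue f vs (mul i j) = lookup vs i ⊛ lookup vs j

  -- Entry i is the value of the gate with address i.
  values : {I : Set a} → (I → Carrier) → Gates I s → Vec Carrier s
  values f []      = []
  values f (C ▷ g) = values f C ∷ʳ gateValue f (values f C) g

  -- fι_j(Y), for f zero outside ℱ.
  intersectionTransform : (ℱ : Family n) → (Member ℱ → Carrier) → ℕ → Subset n → Carrier
  intersectionTransform ℱ f j Y =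
    foldr _⊕_ 0# (map f (filter (λ X → ∣ proj₁ X ∩ Y ∣ ≟ j) (members ℱ)))

  CorrectOutput : (ℱ : Family n) (C : Circuit (Member ℱ) (Fin (suc n) × Subset n)) →
                  (Member ℱ → Carrier) → (Fin (suc n) × Subset n) × Fin (size C) → Set ℓ
  CorrectOutput ℱ C f ((j , Y) , g) =
    lookup (values f (gates C)) g ≈ intersectionTransform ℱ f (toℕ j) Y

  record ComputesIntersectionTransform
      (ℱ 𝒢 : Family n) (C : Circuit (Member ℱ) (Fin (suc n) × Subset n)) : Set (c Level.⊔ ℓ) where
    field
      oneInputPerMember : inputLabels (gates C) ↭ members ℱ
      oneOutputPerPair  : map proj₁ (outputs C) ↭ cartesianProduct (allFin (suc n)) 𝒢
      distinctOutputs   : Unique (map proj₂ (outputs C))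
      correct           : (f : Member ℱ → Carrier) → All (CorrectOutput ℱ C f) (outputs C)

-- Model of computation: a first-order, call-by-value LISP-like language.
--
-- Data are numbers and pairs.  A program is a fixed finite table of
-- mutually recursive unary functions together with a main expression.  Each
-- evaluation rule costs one unit, as on a pointer machine or a RAM: it
-- copies a reference, allocates one cell, inspects the top of one datum,
-- adds or subtracts one, or binds a fixed number of variables.  The only
-- arithmetic is successor and predecessor, so t steps raise the largest
-- number in memory by at most t; there is no unit-cost equality test.

data Val : Set where
  num  : ℕ → Val
  pair : Val → Val → Val

-- m: number of functions in the table; k: number of variables in scope.
data Exp (m k : ℕ) : Set where
  var   : Fin k → Exp m k
  zeroᵉ : Exp m k
  sucᵉ  : Exp m k → Exp m k
  pairᵉ : Exp m k → Exp m k → Exp m k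
  -- case e of { 0 → e₀ ; suc x → e₁ ; pair x y → e₂ },
  -- with x variable 0, and y variable 1, in the branches.
  caseᵉ : Exp m k → Exp m k → Exp m (suc k) → Exp m (suc (suc k)) → Exp m k
  letᵉ  : Exp m k → Exp m (suc k) → Exp m k
  call  : Fin m → Exp m k → Exp m k

record Program : Set where
  field
    arity : ℕ
    table : Vec (Exp arity 1) arity
    main  : Exp arity 1

-- The successor of a pair is 0, so that only non-termination prevents a value.
sucᵛ : Val → Val
sucᵛ (num i)    = num (suc i)
sucᵛ (pair _ _) = num 0

-- T , ρ ⊢ e ⇓ v ∣ t : in environment ρ, e evaluates to v in time t.
infix 4 _,_⊢_⇓_∣_
data _,_⊢_⇓_∣_ (T : Vec (Exp m 1) m) (ρ : Vec Val k) : Exp m k → Val → ℕ → Set where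

  ⇓var : ∀ {x} →
    T , ρ ⊢ var x ⇓ lookup ρ x ∣ 1

  ⇓zero :
    T , ρ ⊢ zeroᵉ ⇓ num 0 ∣ 1

  ⇓suc : ∀ {e v t} →
    T , ρ ⊢ e ⇓ v ∣ t →
    T , ρ ⊢ sucᵉ e ⇓ sucᵛ v ∣ suc t

  ⇓pair : ∀ {e e′ v v′ t t′} →
    T , ρ ⊢ e ⇓ v ∣ t →
    T , ρ ⊢ e′ ⇓ v′ ∣ t′ →
    T , ρ ⊢ pairᵉ e e′ ⇓ pair v v′ ∣ suc (t + t′)

  ⇓case-zero : ∀ {e e₀ e₁ e₂ v t t′} →
    T , ρ ⊢ e ⇓ num 0 ∣ t →
    T , ρ ⊢ e₀ ⇓ v ∣ t′ →
    T , ρ ⊢ caseᵉ e e₀ e₁ e₂ ⇓ v ∣ suc (t + t′)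

  ⇓case-suc : ∀ {e e₀ e₁ e₂ i v t t′} →
    T , ρ ⊢ e ⇓ num (suc i) ∣ t →
    T , (num i ∷ ρ) ⊢ e₁ ⇓ v ∣ t′ →
    T , ρ ⊢ caseᵉ e e₀ e₁ e₂ ⇓ v ∣ suc (t + t′)

  ⇓case-pair : ∀ {e e₀ e₁ e₂ x y v t t′} →
    T , ρ ⊢ e ⇓ pair x y ∣ t →
    T , (x ∷ y ∷ ρ) ⊢ e₂ ⇓ v ∣ t′ →
    T , ρ ⊢ caseᵉ e e₀ e₁ e₂ ⇓ v ∣ suc (t + t′)

  ⇓let : ∀ {e e′ v v′ t t′} →
    T , ρ ⊢ e ⇓ v ∣ t →
    T , (v ∷ ρ) ⊢ e′ ⇓ v′ ∣ t′ →
    T , ρ ⊢ letᵉ e e′ ⇓ v′ ∣ suc (t + t′)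

  ⇓call : ∀ {h e v v′ t t′} →
    T , ρ ⊢ e ⇓ v ∣ t →
    T , (v ∷ []) ⊢ lookup T h ⇓ v′ ∣ t′ →
    T , ρ ⊢ call h e ⇓ v′ ∣ suc (t + t′)

_⟨_⟩⇓_inTime_ : Program → Val → Val → ℕ → Set
P ⟨ v ⟩⇓ w inTime t = Program.table P , (v ∷ []) ⊢ Program.main P ⇓ w ∣ t

encodeList : {A : Set a} → (A → Val) → List A → Val
encodeList enc = foldr (λ x v → pair (enc x) v) (num 0)

encodeBit : Bool → Val
encodeBit false = num 0
encodeBit true  = num 1

encodeSubset : Subset n → Val
encodeSubset X = encodeList encodeBit (toList X)

encodeInstance : Family n → Family n → Val
encodeInstance {n} ℱ 𝒢 =
  pair (num n) (pair (encodeList encodeSubset ℱ) (encodeList encodeSubset 𝒢))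

encodeFin : Fin s → Val
encodeFin i = num (toℕ i)

encodeℤ : ℤ → Val
encodeℤ (+ i)    = pair (num 0) (num i)
encodeℤ -[1+ i ] = pair (num 1) (num (suc i))

module _ {I : Set a} (encI : I → Val) where

  encodeGate : Gate I s → Val
  encodeGate (input x) = pair (num 0) (encI x)
  encodeGate (const z) = pair (num 1) (encodeℤ z)
  encodeGate (add i j) = pair (num 2) (pair (encodeFin i) (encodeFin j))
  encodeGate (sub i j) = pair (num 3) (pair (encodeFin i) (encodeFin j))
  encodeGate (mul i j) = pair (num 4) (pair (encodeFin i) (encodeFin j))

  -- A list with the gate of the highest address at its head.
  encodeGates : Gates I s → Val
  encodeGates []      = num 0
  encodeGates (C ▷ g) = pair (encodeGate g) (encodeGates C)

encodeOutput : (Fin (suc n) × Subset n) × Fin s → Val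
encodeOutput ((j , Y) , g) = pair (pair (encodeFin j) (encodeSubset Y)) (encodeFin g)

-- The input gate for f(X) is written as X, without the proof of X ∈ ℱ.
encodeCircuit : {ℱ : Family n} → Circuit (Member ℱ) (Fin (suc n) × Subset n) → Val
encodeCircuit C =
  pair (encodeGates (λ X → encodeSubset (proj₁ X)) (gates C))
       (encodeList encodeOutput (outputs C))

-- Coefficients, constant term first.  Natural coefficients suffice, since
-- every polynomial is bounded above on ℕ by one of these.
Polynomial : Set
Polynomial = List ℕ

evalPoly : Polynomial → ℕ → ℕ
evalPoly p x = foldr (λ a₀ r → a₀ + x * r) 0 p

-- The maximum with 1 matters only if ℱ and 𝒢 are both empty, when the sum
-- is 0 although every run takes at least one step.
bound : Polynomial → Family n → Family n → ℕ
bound {n} p ℱ 𝒢 = evalPoly p n * (1 ⊔ (length (↓ ℱ) + length (↓ 𝒢)))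

{-# OPTIONS --safe #-}
module Submission where

-- With x a formal variable, ∑ⱼ fι_j(Y) xʲ = ∑_{Z ⊆ Y} (x − 1)^|Z| f⁺(Z), where f⁺(Z) is the
-- sum of f over the members of ℱ above Z.  Both steps, f ↦ f⁺ and the sum over Z ⊆ Y, act on
-- one coordinate at a time.  On a binary trie whose leaves are ↓(ℱ ∪ 𝒢) they read
--   (l , r) ↦ (l + r , r)    and    (l , r) ↦ (l , l + (x − 1) r),
-- and as the family is down-closed every leaf of r has a counterpart in l, so neither step
-- leaves the family.  The first step, applied to the trie of ℱ ∪ 𝒢 with + the union of
-- tries, creates the down-closure by itself.

open import Algebra.Bundles using (Ring)
import Algebra.Properties.AbelianGroup as AbelianGroupProperties
import Algebra.Properties.CommutativeSemigroup as CommutativeSemigroupProperties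
open import Data.Bool.Base using (Bool; true; false; if_then_else_)
open import Data.Empty using (⊥-elim)
open import Data.Fin.Base using (Fin; zero; suc; toℕ; inject₁; fromℕ)
open import Data.Fin.Patterns
open import Data.Fin.Properties using (toℕ-inject₁; toℕ-fromℕ; fromℕ≢inject₁; inject₁-injective)
open import Data.Fin.Subset using (Subset; inside; outside; _∩_; ∣_∣; _⊆_)
open import Data.Fin.Subset.Properties using (_⊆?_; ⊆-refl; out⊆; in⊆in)
open import Data.Integer.Base using (+_)
open import Data.List.Base
  using (List; []; _∷_; _++_; length; map; filter; foldr; tabulate; allFin; cartesianProduct)
open import Data.List.Membership.Propositional using (_∈_; lose)
open import Data.List.Membership.Propositional.Properties
  using (∈-map⁺; ∈-++⁺ˡ; ∈-++⁺ʳ; ∈-++⁻; ∈-∃++; ∈-filter⁺; map-mapWith∈; mapWith∈-id)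
open import Data.List.Properties
  using (++-assoc; ++-identityʳ; length-++; length-map; map-∘; map-tabulate; filter-++;
         filter-accept; filter-reject; cartesianProductWith-zeroʳ)
open import Data.List.Relation.Binary.Permutation.Propositional
  using (_↭_; ↭-refl; ↭-sym; ↭-trans; ↭-reflexive; prep)
open import Data.List.Relation.Binary.Permutation.Propositional.Properties using (++⁺ˡ; shifts)
open import Data.List.Relation.Unary.All as All using (All; []; _∷_)
import Data.List.Relation.Unary.All.Properties as All
open import Data.List.Relation.Unary.AllPairs using ([]; _∷_)
open import Data.List.Relation.Unary.Any using (Any; here; there; any?)
open import Data.List.Relation.Unary.Unique.Propositional using (Unique)
import Data.List.Relation.Unary.Unique.Propositional.Properties as Unique
open import Data.Nat.Base using (ℕ; zero; suc; _+_; _*_; _⊔_; _≤_; z≤n; s≤s)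
open import Data.Nat.Properties as ℕ
  using (_≟_; suc-injective; ≤-refl; ≤-trans; ≤-reflexive; n≤1+n; m≤m+n; m≤n+m; m≤n⇒m≤n+o; m≤n⇒m≤1+n;
         +-mono-≤; +-monoˡ-≤; +-monoʳ-≤; *-monoˡ-≤; *-monoʳ-≤; m≤m⊔n; m≤n⊔m; ⊔-lub; module ≤-Reasoning)
open import Data.Nat.Tactic.RingSolver using (solve-∀)
open import Data.Product.Base using (Σ; ∃; Σ-syntax; ∃-syntax; _×_; _,_; proj₁; proj₂)
open import Data.Sum.Base using (_⊎_; inj₁; inj₂) renaming (map to map-⊎)
open import Data.Unit.Polymorphic.Base using (⊤)
open import Data.Vec.Base using (Vec; []; _∷_; _∷ʳ_; lookup; replicate)
open import Data.Vec.Properties using (lookup-replicate)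
open import Function.Base using (_∘_)
open import Level using (Level) renaming (_⊔_ to _⊔ˡ_)
open import Relation.Binary.PropositionalEquality
  using (_≡_; _≢_; refl; sym; trans; cong; cong₂; subst; subst₂)
open import Relation.Nullary.Decidable.Core using (yes; no; does; _⊎-dec_)
open import Relation.Nullary.Negation.Core using (contradiction)
open import Relation.Unary using (Pred; Decidable)
open import Defs

-- The identity is the binomial theorem: x^|X ∩ Y| is the sum of (x - 1)^|Z| over Z ⊆ X ∩ Y, and
-- exchanging the sums over X and Z produces f⁺. Multiplication by x - 1 never moves a coefficient
-- down, so polynomials may be cut off after n + 1 coefficients; only sums and differences in R
-- occur. The members of 𝒢 enter with value 0: they add nothing to any sum, but make every Y in 𝒢 a
-- leaf at which the result can be read off. The time bound forbids touching subsets outside the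
-- tries. Zipping descends only where both tries have a node, so the weight of its first argument
-- alone pays for it; each call puts there a trie that is small or that can be charged to a known
-- one. The trie of ℱ ∪ 𝒢 may be exponentially smaller than its down-closure, hence the first step
-- is charged to its output. Each of the n levels is charged at most once, and a trie in which every
-- node has a leaf below it weighs at most 2n per leaf, plus 1. The program never sees R. What a
-- gate means is a function of f, tracked by invariants of the runs.

private
  variable
    a p q : Level
    A B : Set a
    n k m s s′ s″ : ℕ
    x y z : Val

-- Binary tries keyed by subsets

data Trie (A : Set a) : ℕ → Set a where
  empty : Trie A n
  leaf  : A → Trie A 0
  node  : Trie A n → Trie A n → Trie A (suc n)

-- Empty subtries count, so that the weight bounds the work of a traversal.
weight : Trie A n → ℕ
weight empty      = 1
weight (leaf _)   = 1
weight (node l r) = suc (weight l + weight r)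

singleton : Subset n → A → Trie A n
singleton []            x = leaf x
singleton (outside ∷ X) x = node (singleton X x) empty
singleton (inside ∷ X)  x = node empty (singleton X x)

-- The union of two tries if keep holds, their intersection otherwise.
zipTrie : Bool → (A → A → A) → Trie A n → Trie A n → Trie A n
zipTrie keep f empty      t            = if keep then t else empty
zipTrie keep f (leaf x)   empty        = if keep then leaf x else empty
zipTrie keep f (leaf x)   (leaf y)     = leaf (f x y)
zipTrie keep f (node l r) empty        = if keep then node l r else empty
zipTrie keep f (node l r) (node l′ r′) = node (zipTrie keep f l l′) (zipTrie keep f r r′)

-- The program

-- A function that emits gates takes, along with its proper arguments, a state (s , gates) with
-- s the next free address, and returns its result paired with the new state.

arity : ℕ
arity = 15

pattern emitᶠ      = 0F
pattern singletonᶠ = 1F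
pattern addᶠ       = 2F
pattern mergeᶠ     = 3F
pattern build𝒢ᶠ    = 4F
pattern buildℱᶠ    = 5F
pattern zetaᶠ      = 6F
pattern zerosᶠ     = 7F
pattern combineᶠ   = 8F
pattern combine₀ᶠ  = 9F
pattern restrictᶠ  = suc 9F
pattern evaluateᶠ  = suc (suc 9F)
pattern findᶠ      = suc (suc (suc 9F))
pattern outputᶠ    = suc (suc (suc (suc 9F)))
pattern outputsᶠ   = suc (suc (suc (suc (suc 9F))))

pattern ν₀ = var 0F
pattern ν₁ = var 1F
pattern ν₂ = var 2F
pattern ν₃ = var 3F
pattern ν₄ = var 4F
pattern ν₅ = var 5F
pattern ν₆ = var 6F
pattern ν₇ = var 7F
pattern ν₉ = var 9F
pattern ν₁₀ = var (suc 9F)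

Code : ℕ → Set
Code = Exp arity

-- The branches filled with zeroᵉ are never reached.
onPair : Code k → Code (suc (suc k)) → Code k
onPair e e′ = caseᵉ e zeroᵉ zeroᵉ e′

onDatum : Code k → Code k → Code (suc (suc k)) → Code k
onDatum e e₀ e₂ = caseᵉ e e₀ zeroᵉ e₂

onBit : Code k → Code k → Code (suc k) → Code k
onBit e e₀ e₁ = caseᵉ e e₀ e₁ zeroᵉ

⟨_,_⟩ : Code k → Code k → Code k
⟨ e , e′ ⟩ = pairᵉ e e′

-- Tries are encoded by empty ↦ 0, leaf a ↦ (0 , a) and node l r ↦ ((l , r) , 0); subsets
-- and vectors are encoded as lists.
leafᵉ : Code k → Code k
leafᵉ e = ⟨ zeroᵉ , e ⟩

nodeᵉ : Code k → Code k → Code k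
nodeᵉ l r = ⟨ ⟨ l , r ⟩ , zeroᵉ ⟩

addᵉ subᵉ : Code k → Code k → Code k
addᵉ e e′ = ⟨ sucᵉ (sucᵉ zeroᵉ) , ⟨ e , e′ ⟩ ⟩
subᵉ e e′ = ⟨ sucᵉ (sucᵉ (sucᵉ zeroᵉ)) , ⟨ e , e′ ⟩ ⟩

emitCode : Code 1
emitCode = onPair ν₀ (onPair ν₁ ⟨ ν₀ , ⟨ sucᵉ ν₀ , ⟨ ν₂ , ν₁ ⟩ ⟩ ⟩)

singletonCode : Code 1
singletonCode =
  onPair ν₀ (onDatum ν₁ (leafᵉ ν₀)
    (letᵉ (call singletonᶠ ⟨ ν₂ , ν₁ ⟩)
      (onBit ν₁ (nodeᵉ ν₀ zeroᵉ) (nodeᵉ zeroᵉ ν₁))))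

addCode : Code 1
addCode = onPair ν₀ (call emitᶠ ⟨ ⟨ sucᵉ (sucᵉ zeroᵉ) , ν₁ ⟩ , ν₀ ⟩)

zipCode : (keep : Bool) (self op : Fin arity) → Code 1
zipCode keep self op =
  onPair ν₀ (onPair ν₁
    (onDatum ν₀ ⟨ if keep then ν₁ else zeroᵉ , ν₂ ⟩
      (onDatum ν₃ ⟨ if keep then ν₂ else zeroᵉ , ν₄ ⟩
        (onDatum ν₂
          (onPair (call op ⟨ ν₆ , ⟨ ν₃ , ν₁ ⟩ ⟩) ⟨ leafᵉ ν₀ , ν₁ ⟩)
          (onPair ν₂
            (onPair (call self ⟨ ν₁₀ , ⟨ ν₂ , ν₀ ⟩ ⟩)
              (onPair (call self ⟨ ν₁ , ⟨ ν₅ , ν₃ ⟩ ⟩)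
                ⟨ nodeᵉ ν₂ ν₀ , ν₁ ⟩)))))))

-- Gate 0 is the constant 0; the members of 𝒢 enter the trie with this value.
build𝒢Code : Code 1
build𝒢Code =
  onPair ν₀ (onDatum ν₁ ⟨ zeroᵉ , ν₀ ⟩
    (onPair (call build𝒢ᶠ ⟨ ν₂ , ν₁ ⟩)
      (call mergeᶠ ⟨ ν₁ , ⟨ call singletonᶠ ⟨ zeroᵉ , ν₂ ⟩ , ν₀ ⟩ ⟩)))

buildℱCode : Code 1
buildℱCode =
  onPair ν₀ (onDatum ν₁ ν₀
    (onPair (call buildℱᶠ ⟨ ν₂ , ν₁ ⟩)
      (onPair (call emitᶠ ⟨ ⟨ zeroᵉ , ν₂ ⟩ , ν₁ ⟩)
        (call mergeᶠ ⟨ ν₁ , ⟨ call singletonᶠ ⟨ ν₀ , ν₄ ⟩ , ν₂ ⟩ ⟩))))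

zetaCode : Code 1
zetaCode =
  onPair ν₀ (onDatum ν₁ ⟨ ν₁ , ν₀ ⟩
    (onDatum ν₀ ⟨ ν₃ , ν₂ ⟩
      (onPair (call zetaᶠ ⟨ ν₄ , ν₀ ⟩)
        (onPair (call zetaᶠ ⟨ ν₁ , ν₃ ⟩)
          (onPair (call mergeᶠ ⟨ ν₁ , ⟨ ν₂ , ν₀ ⟩ ⟩)
            ⟨ nodeᵉ ν₀ ν₂ , ν₁ ⟩)))))

zerosCode : Code 1
zerosCode = caseᵉ ν₀ zeroᵉ ⟨ zeroᵉ , call zerosᶠ ν₀ ⟩ zeroᵉ

combineCode : Code 1
combineCode =
  onPair ν₀ (onPair ν₀ (onPair ν₃
    (onDatum ν₀ ⟨ zeroᵉ , ν₂ ⟩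
      (onPair ν₃
        (onPair (call emitᶠ ⟨ subᵉ ν₂ ν₀ , ν₆ ⟩)
          (onPair (call emitᶠ ⟨ addᵉ ν₀ ν₉ , ν₁ ⟩)
            -- The head `ν₄` of the second vector is the preceding coefficient for the tails.
            (onPair (call combineᶠ ⟨ ⟨ ν₁ , ν₄ ⟩ , ⟨ ν₇ , ν₅ ⟩ ⟩)
              ⟨ ⟨ ν₂ , ν₀ ⟩ , ν₁ ⟩)))))))

combine₀Code : Code 1
combine₀Code = onPair ν₀ (call combineᶠ ⟨ ⟨ ν₀ , zeroᵉ ⟩ , ν₁ ⟩)

evaluateCode : Code 1
evaluateCode =
  onPair ν₀ (onPair ν₀
    (onDatum ν₃ ⟨ ν₃ , ν₀ ⟩
      (onDatum ν₀ ⟨ leafᵉ ⟨ ν₁ , ν₃ ⟩ , ν₂ ⟩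
        (onPair (call evaluateᶠ ⟨ ⟨ ν₄ , ν₅ ⟩ , ν₀ ⟩)
          (onPair (call evaluateᶠ ⟨ ⟨ ν₁ , ν₇ ⟩ , ν₃ ⟩)
            (onPair (call restrictᶠ ⟨ ν₁ , ⟨ ν₂ , ν₀ ⟩ ⟩)
              ⟨ nodeᵉ ν₄ ν₀ , ν₁ ⟩))))))

findCode : Code 1
findCode =
  onPair ν₀ (onPair ν₀
    (onDatum ν₃ ν₁
      (onPair ν₂
        (onBit ν₂ (call findᶠ ⟨ ν₀ , ν₃ ⟩) (call findᶠ ⟨ ν₂ , ν₄ ⟩)))))

-- Emits a fresh gate v + 0 for every output, as distinct outputs may have the same v.
outputCode : Code 1
outputCode =
  onPair ν₀ (onPair ν₀ (onPair ν₃
    (onDatum ν₁ ⟨ ν₃ , ν₂ ⟩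
      (onPair ν₂
        (onPair (call outputᶠ ⟨ ⟨ ν₆ , ν₇ ⟩ , ⟨ ⟨ ν₀ , sucᵉ ν₁ ⟩ , ν₃ ⟩ ⟩)
          (onPair (call emitᶠ ⟨ addᵉ ν₄ zeroᵉ , ν₁ ⟩)
            ⟨ ⟨ ⟨ ⟨ ν₅ , ν₄ ⟩ , ν₀ ⟩ , ν₂ ⟩ , ν₁ ⟩))))))

outputsCode : Code 1
outputsCode =
  onPair ν₀ (onPair ν₀
    (onDatum ν₃ ⟨ zeroᵉ , ν₀ ⟩
      (onPair (call outputsᶠ ⟨ ⟨ ν₂ , ν₃ ⟩ , ν₁ ⟩)
        (call outputᶠ ⟨ ⟨ ν₁ , ν₀ ⟩ ,
                        ⟨ ⟨ ν₂ , zeroᵉ ⟩ , call findᶠ ⟨ ν₅ , ν₂ ⟩ ⟩ ⟩))))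

mainCode : Code 1
mainCode =
  onPair ν₀ (onPair ν₁
    (onPair (call buildℱᶠ ⟨ call build𝒢ᶠ ⟨ initialᵉ , ν₁ ⟩ , ν₀ ⟩)
      (onPair (call zetaᶠ ⟨ ν₁ , ν₀ ⟩)
        (onPair (call evaluateᶠ ⟨ ⟨ ν₁ , call zerosᶠ ν₆ ⟩ , ν₀ ⟩)
          (onPair (call outputsᶠ ⟨ ⟨ ν₁ , ν₀ ⟩ , ν₇ ⟩)
            (onPair ν₁ ⟨ ν₁ , ν₂ ⟩))))))
  where
  oneᵉ initialᵉ : Code k
  oneᵉ     = sucᵉ zeroᵉ
  -- The state of the circuit whose only gate is `const (+ 0)`: next address 1, then the gate with
  -- tag 1 and integer (0 , 0).
  initialᵉ = ⟨ oneᵉ , ⟨ ⟨ oneᵉ , ⟨ zeroᵉ , zeroᵉ ⟩ ⟩ , zeroᵉ ⟩ ⟩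

table : Vec (Code 1) arity
table =
  emitCode ∷ singletonCode ∷ addCode ∷ zipCode true mergeᶠ addᶠ ∷ build𝒢Code ∷
  buildℱCode ∷ zetaCode ∷ zerosCode ∷ combineCode ∷ combine₀Code ∷
  zipCode false restrictᶠ combine₀ᶠ ∷ evaluateCode ∷ findCode ∷ outputCode ∷
  outputsCode ∷ []

program : Program
program = record { arity = arity ; table = table ; main = mainCode }

-- Running times

infix 4 _⊢_⇓_within_
-- Only an upper bound is kept, because the exact time depends on the branches taken.
record _⊢_⇓_within_ {k} (ρ : Vec Val k) (e : Code k) (v : Val) (b : ℕ) : Set where
  constructor within
  field
    {time} : ℕ
    run    : table , ρ ⊢ e ⇓ v ∣ time
    time≤b : time ≤ b

private
  variable
    ρ : Vec Val k
    e e₀ e₁ e₂ e′ : Code k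
    v v′ : Val
    b b′ : ℕ

var′ : ∀ {i : Fin k} → ρ ⊢ var i ⇓ lookup ρ i within 1
var′ = within ⇓var ≤-refl

zero′ : ρ ⊢ zeroᵉ ⇓ num 0 within 1
zero′ = within ⇓zero ≤-refl

suc′ : ρ ⊢ e ⇓ v within b → ρ ⊢ sucᵉ e ⇓ sucᵛ v within suc b
suc′ (within d p) = within (⇓suc d) (s≤s p)

infixr 4 _,′_
_,′_ : ρ ⊢ e ⇓ v within b → ρ ⊢ e′ ⇓ v′ within b′ →
       ρ ⊢ pairᵉ e e′ ⇓ pair v v′ within suc (b + b′)
within d p ,′ within d′ p′ = within (⇓pair d d′) (s≤s (+-mono-≤ p p′))

infixr 3 _⇒⁰_ _⇒¹_ _⇒²_ _⇒ˡ_
_⇒⁰_ : ρ ⊢ e ⇓ num 0 within b → ρ ⊢ e₀ ⇓ v within b′ →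
       ρ ⊢ caseᵉ e e₀ e₁ e₂ ⇓ v within suc (b + b′)
within d p ⇒⁰ within d′ p′ = within (⇓case-zero d d′) (s≤s (+-mono-≤ p p′))

_⇒¹_ : ∀ {i} → ρ ⊢ e ⇓ num (suc i) within b → (num i ∷ ρ) ⊢ e₁ ⇓ v within b′ →
       ρ ⊢ caseᵉ e e₀ e₁ e₂ ⇓ v within suc (b + b′)
within d p ⇒¹ within d′ p′ = within (⇓case-suc d d′) (s≤s (+-mono-≤ p p′))

_⇒²_ : ρ ⊢ e ⇓ pair x y within b → (x ∷ y ∷ ρ) ⊢ e₂ ⇓ v within b′ →
       ρ ⊢ caseᵉ e e₀ e₁ e₂ ⇓ v within suc (b + b′)
within d p ⇒² within d′ p′ = within (⇓case-pair d d′) (s≤s (+-mono-≤ p p′))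

_⇒ˡ_ : ρ ⊢ e ⇓ v within b → (v ∷ ρ) ⊢ e′ ⇓ v′ within b′ →
       ρ ⊢ letᵉ e e′ ⇓ v′ within suc (b + b′)
within d p ⇒ˡ within d′ p′ = within (⇓let d d′) (s≤s (+-mono-≤ p p′))

call′ : ∀ {h} → ρ ⊢ e ⇓ v within b → (v ∷ []) ⊢ lookup table h ⇓ v′ within b′ →
        ρ ⊢ call h e ⇓ v′ within suc (b + b′)
call′ (within d p) (within d′ p′) = within (⇓call d d′) (s≤s (+-mono-≤ p p′))

infixl 2 _slack_by_
-- The inequality is given as an equation with explicit surplus `d`, which the ring solver can
-- prove.
_slack_by_ : ρ ⊢ e ⇓ v within b → ∀ d → b′ ≡ b + d → ρ ⊢ e ⇓ v within b′
within {time} r p slack d by eq =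
  within r (subst (time ≤_) (sym eq) (m≤n⇒m≤n+o d p))

-- `Q` will be a relation to a circuit, such as `Addr C`; as the circuit grows, the representation
-- is carried along by `mapTrieRep`.
data TrieRep {A : Set a} (Q : Val → A → Set q) : Val → Trie A n → Set (a ⊔ˡ q) where
  empty : TrieRep Q {n} (num 0) empty
  leaf  : ∀ {v} → Q x v → TrieRep Q (pair (num 0) x) (leaf v)
  node  : {l r : Trie A n} → TrieRep Q x l → TrieRep Q y r →
          TrieRep Q (pair (pair x y) (num 0)) (node l r)

mapTrieRep : {Q Q′ : Val → A → Set q} → (∀ {x v} → Q x v → Q′ x v) →
             {t : Trie A n} → TrieRep Q x t → TrieRep Q′ x t
mapTrieRep f empty      = empty
mapTrieRep f (leaf q)   = leaf (f q)
mapTrieRep f (node l r) = node (mapTrieRep f l) (mapTrieRep f r)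

data VecRep {A : Set a} (Q : Val → A → Set q) : Val → Vec A m → Set (a ⊔ˡ q) where
  []  : VecRep Q (num 0) []
  _∷_ : ∀ {v} {vs : Vec A m} → Q x v → VecRep Q y vs → VecRep Q (pair x y) (v ∷ vs)

mapVecRep : {Q Q′ : Val → A → Set q} → (∀ {x v} → Q x v → Q′ x v) →
            {vs : Vec A m} → VecRep Q x vs → VecRep Q′ x vs
mapVecRep f []       = []
mapVecRep f (q ∷ qs) = f q ∷ mapVecRep f qs

-- In each of the cost lemmas the right-hand side is the time as the evaluation rules add it
-- up, plus the slack.

singleton-cost : ∀ n → suc n * 16 + 7 ≡ 9 + (n * 16 + 7 + 7) + 0
singleton-cost = solve-∀

zip-cost-empty : ∀ c → 1 * (c + 50) ≡ 9 + (c + 41)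
zip-cost-empty = solve-∀

zip-cost-leaf-empty : ∀ c → 1 * (c + 50) ≡ 11 + (c + 39)
zip-cost-leaf-empty = solve-∀

zip-cost-leaf-leaf : ∀ c → 1 * (c + 50) ≡ 17 + (c + 5) + 28
zip-cost-leaf-leaf = solve-∀

zip-cost-node-empty : ∀ c v w → suc (v + w) * (c + 50) ≡ 11 + (c + 39 + (v + w) * (c + 50))
zip-cost-node-empty = solve-∀

zip-cost-node-node : ∀ c v w → suc (v + w) * (c + 50) ≡
  19 + (v * (c + 50) + (7 + (w * (c + 50) + 7))) + (c + 17)
zip-cost-node-node = solve-∀

singleton-run : {Q : Val → A → Set q} {v : A} → Q x v → (X : Subset n) →
  Σ Val λ y → TrieRep Q y (singleton X v) ×
    ((pair x (encodeSubset X) ∷ []) ⊢ singletonCode ⇓ y within (n * 16 + 7))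
singleton-run q [] = _ , leaf q , (var′ ⇒² var′ ⇒⁰ (zero′ ,′ var′))
singleton-run {n = suc n} q (outside ∷ X) =
  let _ , t , r = singleton-run q X in
  _ , node t empty ,
  (var′ ⇒² var′ ⇒² call′ (var′ ,′ var′) r ⇒ˡ var′ ⇒⁰ ((var′ ,′ zero′) ,′ zero′)
    slack 0 by singleton-cost n)
singleton-run {n = suc n} q (inside ∷ X) =
  let _ , t , r = singleton-run q X in
  _ , node empty t ,
  (var′ ⇒² var′ ⇒² call′ (var′ ,′ var′) r ⇒ˡ var′ ⇒¹ ((zero′ ,′ var′) ,′ zero′)
    slack 0 by singleton-cost n)

lookup-∷ʳ-inject₁ : (xs : Vec A n) (w : A) (i : Fin n) →
                    lookup (xs ∷ʳ w) (inject₁ i) ≡ lookup xs i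
lookup-∷ʳ-inject₁ (x ∷ xs) w zero    = refl
lookup-∷ʳ-inject₁ (x ∷ xs) w (suc i) = lookup-∷ʳ-inject₁ xs w i

lookup-∷ʳ-fromℕ : (xs : Vec A n) (w : A) → lookup (xs ∷ʳ w) (fromℕ n) ≡ w
lookup-∷ʳ-fromℕ []       w = refl
lookup-∷ʳ-fromℕ (x ∷ xs) w = lookup-∷ʳ-fromℕ xs w

infixl 2 _upto_
_upto_ : ∀ {k b b′ v} {ρ : Vec Val k} {e : Code k} → ρ ⊢ e ⇓ v within b → b ≤ b′ → ρ ⊢ e ⇓ v within b′
within r p upto b≤b′ = within r (≤-trans p b≤b′)

weight-singleton-left : ∀ n → suc (n * 2 + 1 + 1) ≡ suc n * 2 + 1
weight-singleton-left = solve-∀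

weight-singleton-right : ∀ n → suc (suc (n * 2 + 1)) ≡ suc n * 2 + 1
weight-singleton-right = solve-∀

weight-singleton : (X : Subset n) (v : A) → weight (singleton X v) ≡ n * 2 + 1
weight-singleton []            v = refl
weight-singleton {n = suc n} (outside ∷ X) v =
  trans (cong (λ w → suc (w + 1)) (weight-singleton X v)) (weight-singleton-left n)
weight-singleton {n = suc n} (inside ∷ X)  v =
  trans (cong (λ w → suc (suc w)) (weight-singleton X v)) (weight-singleton-right n)

-- Allows a merge, paid for by its first argument, to be charged to the merged trie.
weight-zip-keep : (f : A → A → A) (t u : Trie A n) → weight t ≤ weight (zipTrie true f t u)
weight-zip-keep f empty      empty        = ≤-refl
weight-zip-keep f empty      (leaf _)     = ≤-refl
weight-zip-keep f empty      (node _ _)   = s≤s z≤n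
weight-zip-keep f (leaf x)   empty        = ≤-refl
weight-zip-keep f (leaf x)   (leaf y)     = ≤-refl
weight-zip-keep f (node l r) empty        = ≤-refl
weight-zip-keep f (node l r) (node l′ r′) =
  s≤s (+-mono-≤ (weight-zip-keep f l l′) (weight-zip-keep f r r′))

-- The second argument is the subtrie that `evaluate` restricts, so its weight is the budget for the
-- restricted one.
weight-zip-drop : (f : A → A → A) (t u : Trie A n) → weight (zipTrie false f t u) ≤ weight u
weight-zip-drop f empty      empty        = ≤-refl
weight-zip-drop f empty      (leaf _)     = ≤-refl
weight-zip-drop f empty      (node _ _)   = s≤s z≤n
weight-zip-drop f (leaf x)   empty        = ≤-refl
weight-zip-drop f (leaf x)   (leaf y)     = ≤-refl
weight-zip-drop f (node l r) empty        = ≤-refl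
weight-zip-drop f (node l r) (node l′ r′) =
  s≤s (+-mono-≤ (weight-zip-drop f l l′) (weight-zip-drop f r r′))

data At {A : Set a} : Trie A n → Subset n → A → Set a where
  here  : ∀ {v} → At (leaf v) [] v
  left  : ∀ {l r : Trie A n} {X v} → At l X v → At (node l r) (outside ∷ X) v
  right : ∀ {l r : Trie A n} {X v} → At r X v → At (node l r) (inside ∷ X) v

find-cost : ∀ n → suc n * 20 + 8 ≡ 14 + (n * 20 + 8) + 6
find-cost = solve-∀

find-run : {Q : Val → A → Set q} {t : Trie A n} {Y : Subset n} {v : A} →
  TrieRep Q x t → At t Y v →
  Σ Val λ y → Q y v × ((pair x (encodeSubset Y) ∷ []) ⊢ findCode ⇓ y within (n * 20 + 8))
find-run (leaf p) here = _ , p , (var′ ⇒² var′ ⇒² var′ ⇒⁰ var′ slack 1 by refl)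
find-run {n = suc n} (node l r) (left at) =
  let _ , p , run = find-run l at in
  _ , p , (var′ ⇒² var′ ⇒² var′ ⇒² var′ ⇒² var′ ⇒⁰ call′ (var′ ,′ var′) run slack 6 by find-cost n)
find-run {n = suc n} (node l r) (right at) =
  let _ , p , run = find-run r at in
  _ , p , (var′ ⇒² var′ ⇒² var′ ⇒² var′ ⇒² var′ ⇒¹ call′ (var′ ,′ var′) run slack 6 by find-cost n)

build𝒢-cost-[] : ∀ n → 1 * (n * 160 + 120) ≡ 7 + (n * 160 + 113)
build𝒢-cost-[] = solve-∀

build𝒢-cost-∷ : ∀ g n → suc (suc g) * (n * 160 + 120) ≡
  9 + (suc g * (n * 160 + 120) + (8 + (n * 16 + 7 + 1 + (n * 2 + 1) * 72))) + 23
build𝒢-cost-∷ = solve-∀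

buildℱ-cost-[] : ∀ n → 1 * (n * 160 + 160) ≡ 5 + (n * 160 + 155)
buildℱ-cost-[] = solve-∀

buildℱ-cost-∷ : ∀ g n → suc (suc g) * (n * 160 + 160) ≡
  9 + (suc g * (n * 160 + 160) + (27 + (n * 16 + 7 + 1 + (n * 2 + 1) * 72))) + 44
buildℱ-cost-∷ = solve-∀

zeta-cost : ∀ n v w → suc (suc n) * (suc (v + w) * 100) ≡
  11 + (suc n * (v * 100) + (5 + (suc n * (w * 100) + (7 + (v * 72 + 7))))) +
  (n * 100 + 170 + v * 28 + w * 100)
zeta-cost = solve-∀

combine-cost : ∀ m → suc m * 80 + 12 ≡ 66 + (m * 80 + 12 + 5) + 9
combine-cost = solve-∀

combine₀-cost : ∀ m → m * 80 + 20 ≡ 8 + (m * 80 + 12) + 0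
combine₀-cost = solve-∀

evaluate-cost-empty : ∀ n N → suc n * (1 * (N * 80 + 200)) ≡
  9 + (N * 80 + 191 + n * (N * 80 + 200))
evaluate-cost-empty = solve-∀

evaluate-cost-leaf : ∀ N → 1 * (1 * (N * 80 + 200)) ≡ 15 + (N * 80 + 185)
evaluate-cost-leaf = solve-∀

evaluate-cost-node : ∀ n N v w → suc (suc n) * (suc (v + w) * (N * 80 + 200)) ≡
  15 + (suc n * (v * (N * 80 + 200)) + (7 + (suc n * (w * (N * 80 + 200)) +
    (7 + (v * (suc N * 80 + 20 + 50) + 7))))) +
  (n * (N * 80 + 200) + N * 160 + 364 + v * 50 + w * (N * 80 + 200))
evaluate-cost-node = solve-∀

output-cost : ∀ m → suc m * 70 + 11 ≡ 22 + (m * 70 + 11 + 32) + 16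
output-cost = solve-∀

outputs-cost-[] : ∀ n → 1 * (n * 100 + 150) ≡ 9 + (n * 100 + 141)
outputs-cost-[] = solve-∀

outputs-cost-∷ : ∀ g n → suc (suc g) * (n * 100 + 150) ≡
  13 + (suc g * (n * 100 + 150) + (13 + (n * 20 + 8 + (suc n * 70 + 11)))) + (n * 10 + 35)
outputs-cost-∷ = solve-∀

encodeList-cong : {A B : Set a} {enc : A → Val} {enc′ : B → Val} (f : A → B) →
  (∀ x → enc′ (f x) ≡ enc x) → (xs : List A) → encodeList enc′ (map f xs) ≡ encodeList enc xs
encodeList-cong f eq []       = refl
encodeList-cong f eq (x ∷ xs) = cong₂ pair (eq x) (encodeList-cong f eq xs)

-- Families as tries

infix 4 _∈ᵗ_
_∈ᵗ_ : {A : Set a} → Subset n → Trie A n → Set a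
Y ∈ᵗ t = ∃ (At t Y)

∈ᵗ-left : {l r : Trie A n} {Y : Subset n} → Y ∈ᵗ l → outside ∷ Y ∈ᵗ node l r
∈ᵗ-left (_ , at) = _ , left at

∈ᵗ-right : {l r : Trie A n} {Y : Subset n} → Y ∈ᵗ r → inside ∷ Y ∈ᵗ node l r
∈ᵗ-right (_ , at) = _ , right at

At-zip : ∀ keep (f : A → A → A) {t u : Trie A n} {Y v w} →
         At t Y v → At u Y w → At (zipTrie keep f t u) Y (f v w)
At-zip keep f here       here        = here
At-zip keep f (left at)  (left at′)  = left (At-zip keep f at at′)
At-zip keep f (right at) (right at′) = right (At-zip keep f at at′)

module _ (f : A → A → A) where

  ∈ᵗ-zipˡ : (t u : Trie A n) {Y : Subset n} → Y ∈ᵗ t → Y ∈ᵗ zipTrie true f t u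
  ∈ᵗ-zipˡ (leaf _)   empty        p             = p
  ∈ᵗ-zipˡ (leaf _)   (leaf _)     (_ , here)    = _ , here
  ∈ᵗ-zipˡ (node _ _) empty        p             = p
  ∈ᵗ-zipˡ (node l _) (node l′ _)  (_ , left p)  = ∈ᵗ-left (∈ᵗ-zipˡ l l′ (_ , p))
  ∈ᵗ-zipˡ (node _ r) (node _ r′)  (_ , right p) = ∈ᵗ-right (∈ᵗ-zipˡ r r′ (_ , p))

  ∈ᵗ-zipʳ : (t u : Trie A n) {Y : Subset n} → Y ∈ᵗ u → Y ∈ᵗ zipTrie true f t u
  ∈ᵗ-zipʳ empty      u            p             = p
  ∈ᵗ-zipʳ (leaf _)   (leaf _)     (_ , here)    = _ , here
  ∈ᵗ-zipʳ (node l _) (node l′ _)  (_ , left p)  = ∈ᵗ-left (∈ᵗ-zipʳ l l′ (_ , p))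
  ∈ᵗ-zipʳ (node _ r) (node _ r′)  (_ , right p) = ∈ᵗ-right (∈ᵗ-zipʳ r r′ (_ , p))

  ∈ᵗ-zip⁻ : (t u : Trie A n) {Y : Subset n} → Y ∈ᵗ zipTrie true f t u → Y ∈ᵗ t ⊎ Y ∈ᵗ u
  ∈ᵗ-zip⁻ empty      u           p             = inj₂ p
  ∈ᵗ-zip⁻ (leaf _)   empty       p             = inj₁ p
  ∈ᵗ-zip⁻ (leaf _)   (leaf _)    (_ , here)    = inj₁ (_ , here)
  ∈ᵗ-zip⁻ (node _ _) empty       p             = inj₁ p
  ∈ᵗ-zip⁻ (node l _) (node l′ _) (_ , left p)  = map-⊎ ∈ᵗ-left ∈ᵗ-left (∈ᵗ-zip⁻ l l′ (_ , p))
  ∈ᵗ-zip⁻ (node _ r) (node _ r′) (_ , right p) = map-⊎ ∈ᵗ-right ∈ᵗ-right (∈ᵗ-zip⁻ r r′ (_ , p))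

∈ᵗ-singleton : (X : Subset n) (v : A) → X ∈ᵗ singleton X v
∈ᵗ-singleton []            v = v , here
∈ᵗ-singleton (outside ∷ X) v = ∈ᵗ-left (∈ᵗ-singleton X v)
∈ᵗ-singleton (inside ∷ X)  v = ∈ᵗ-right (∈ᵗ-singleton X v)

∈ᵗ-singleton⁻ : (X : Subset n) {v : A} {Y : Subset n} → Y ∈ᵗ singleton X v → Y ≡ X
∈ᵗ-singleton⁻ []            (_ , here)    = refl
∈ᵗ-singleton⁻ (outside ∷ X) (_ , left p)  = cong (outside ∷_) (∈ᵗ-singleton⁻ X (_ , p))
∈ᵗ-singleton⁻ (inside ∷ X)  (_ , right p) = cong (inside ∷_) (∈ᵗ-singleton⁻ X (_ , p))

-- Stated one coordinate at a time: an inside may be turned into an outside. This suffices, as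
-- subsets arise by removing elements one by one.
DownClosed : {A : Set a} → Trie A n → Set a
DownClosed empty      = ⊤
DownClosed (leaf _)   = ⊤
DownClosed (node l r) = (∀ {Y} → Y ∈ᵗ r → Y ∈ᵗ l) × DownClosed l × DownClosed r

downClosed-zip : (f : A → A → A) (t u : Trie A n) →
                 DownClosed t → DownClosed u → DownClosed (zipTrie true f t u)
downClosed-zip f empty      u            ct cu = cu
downClosed-zip f (leaf _)   empty        ct cu = ct
downClosed-zip f (leaf _)   (leaf _)     ct cu = _
downClosed-zip f (node _ _) empty        ct cu = ct
downClosed-zip f (node l r) (node l′ r′) (r⊆l , cl , cr) (r′⊆l′ , cl′ , cr′) =
  r⊆l∪l′ , downClosed-zip f l l′ cl cl′ , downClosed-zip f r r′ cr cr′
  where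
  r⊆l∪l′ : ∀ {Y} → Y ∈ᵗ zipTrie true f r r′ → Y ∈ᵗ zipTrie true f l l′
  r⊆l∪l′ p with ∈ᵗ-zip⁻ f r r′ p
  ... | inj₁ q = ∈ᵗ-zipˡ f l l′ (r⊆l q)
  ... | inj₂ q = ∈ᵗ-zipʳ f l l′ (r′⊆l′ q)

-- Counting leaves, nodes and subsets

leaves : Trie A n → ℕ
leaves empty      = 0
leaves (leaf _)   = 1
leaves (node l r) = leaves l + leaves r

leaves≥1 : {t : Trie A n} {Y : Subset n} → Y ∈ᵗ t → 1 ≤ leaves t
leaves≥1 (_ , here)                     = ≤-refl
leaves≥1 {t = node l r} (_ , left at)   = ≤-trans (leaves≥1 (_ , at)) (m≤m+n (leaves l) (leaves r))
leaves≥1 {t = node l r} (_ , right at)  = ≤-trans (leaves≥1 (_ , at)) (m≤n+m (leaves r) (leaves l))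

-- Nodes without a leaf below them would have weight that no set of the family accounts for.
Pruned : {A : Set a} → Trie A n → Set a
Pruned empty      = ⊤
Pruned (leaf _)   = ⊤
Pruned (node l r) = ∃ (_∈ᵗ node l r) × Pruned l × Pruned r

pruned-singleton : (X : Subset n) (v : A) → Pruned (singleton X v)
pruned-singleton []            v = _
pruned-singleton (outside ∷ X) v = (_ , ∈ᵗ-singleton (outside ∷ X) v) , pruned-singleton X v , _
pruned-singleton (inside ∷ X)  v = (_ , ∈ᵗ-singleton (inside ∷ X) v) , _ , pruned-singleton X v

pruned-zip : (f : A → A → A) (t u : Trie A n) → Pruned t → Pruned u → Pruned (zipTrie true f t u)
pruned-zip f empty      u            pt pu = pu
pruned-zip f (leaf _)   empty        pt pu = pt
pruned-zip f (leaf _)   (leaf _)     pt pu = _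
pruned-zip f (node _ _) empty        pt pu = pt
pruned-zip f (node l r) (node l′ r′) ((_ , p) , pl , pr) (_ , pl′ , pr′) =
  (_ , ∈ᵗ-zipˡ f (node l r) (node l′ r′) p) , pruned-zip f l l′ pl pl′ , pruned-zip f r r′ pr pr′

weight-node-leaves : ∀ k l n → suc (k * (n * 2) + 1 + (l * (n * 2) + 1)) ≡ (k + l) * (n * 2) + 1 + 2
weight-node-leaves = solve-∀

leaves-suc : ∀ k n → k * (n * 2) + 1 + k * 2 ≡ k * (suc n * 2) + 1
leaves-suc = solve-∀

-- Each leaf lies below n nodes and every node has a leaf below it, so there are at most n nodes per
-- leaf; a binary tree with k nodes has 2k + 1 parts, empty ones included.
weight≤leaves : (t : Trie A n) → Pruned t → weight t ≤ leaves t * (n * 2) + 1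
weight≤leaves         empty      _             = ≤-refl
weight≤leaves         (leaf _)   _             = ≤-refl
weight≤leaves {n = suc n} (node l r) ((_ , p) , pl , pr) = begin
  suc (weight l + weight r)
    ≤⟨ s≤s (+-mono-≤ (weight≤leaves l pl) (weight≤leaves r pr)) ⟩
  suc (leaves l * (n * 2) + 1 + (leaves r * (n * 2) + 1))
    ≡⟨ weight-node-leaves (leaves l) (leaves r) n ⟩
  (leaves l + leaves r) * (n * 2) + 1 + 2
    -- The leaf `p` below this node pays for the additional 2.
    ≤⟨ +-monoʳ-≤ _ (*-monoˡ-≤ 2 (leaves≥1 p)) ⟩
  (leaves l + leaves r) * (n * 2) + 1 + (leaves l + leaves r) * 2
    ≡⟨ leaves-suc (leaves l + leaves r) n ⟩
  (leaves l + leaves r) * (suc n * 2) + 1 ∎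
  where open ≤-Reasoning

length-filter-map : {P : Pred B p} (P? : Decidable P) (f : A → B) (xs : List A) →
  length (filter P? (map f xs)) ≡ length (filter (P? ∘ f) xs)
length-filter-map P? f []       = refl
length-filter-map P? f (x ∷ xs) with does (P? (f x))
... | true  = cong suc (length-filter-map P? f xs)
... | false = length-filter-map P? f xs

length-filter-⊎ : {P : Pred A p} {Q : Pred A q} (P? : Decidable P) (Q? : Decidable Q) (xs : List A) →
  length (filter (λ x → P? x ⊎-dec Q? x) xs) ≤ length (filter P? xs) + length (filter Q? xs)
length-filter-⊎ P? Q? []       = z≤n
length-filter-⊎ P? Q? (x ∷ xs) with does (P? x) | does (Q? x) | length-filter-⊎ P? Q? xs
... | true  | true  | h = s≤s (≤-trans h (+-monoʳ-≤ (length (filter P? xs)) (n≤1+n _)))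
... | true  | false | h = s≤s h
... | false | true  | h = ≤-trans (s≤s h) (≤-reflexive (sym (ℕ.+-suc _ _)))
... | false | false | h = h

-- Different leaves have different keys, and `allSubsets` splits on the first coordinate exactly as
-- a node does.
leaves≤filter : {P : Pred (Subset n) p} (P? : Decidable P) (t : Trie A n) → (∀ {Y} → Y ∈ᵗ t → P Y) →
  leaves t ≤ length (filter P? (allSubsets n))
leaves≤filter P? empty h = z≤n
leaves≤filter P? (leaf _) h with P? []
... | yes _ = ≤-refl
... | no ¬p = contradiction (h (_ , here)) ¬p
leaves≤filter {n = suc n} P? (node l r) h = begin
  leaves l + leaves r
    ≤⟨ +-mono-≤ (leaves≤filter (P? ∘ (outside ∷_)) l (h ∘ ∈ᵗ-left))
                (leaves≤filter (P? ∘ (inside ∷_)) r (h ∘ ∈ᵗ-right)) ⟩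
  length (filter (P? ∘ (outside ∷_)) (allSubsets n)) + length (filter (P? ∘ (inside ∷_)) (allSubsets n))
    ≡⟨ cong₂ _+_ (length-filter-map P? (outside ∷_) (allSubsets n))
                 (length-filter-map P? (inside ∷_) (allSubsets n)) ⟨
  length (filter P? (map (outside ∷_) (allSubsets n))) + length (filter P? (map (inside ∷_) (allSubsets n)))
    ≡⟨ length-++ (filter P? (map (outside ∷_) (allSubsets n))) ⟨
  length (filter P? (map (outside ∷_) (allSubsets n)) ++ filter P? (map (inside ∷_) (allSubsets n)))
    ≡⟨ cong length (filter-++ P? (map (outside ∷_) (allSubsets n)) _) ⟨
  length (filter P? (allSubsets (suc n))) ∎
  where open ≤-Reasoning

∈-allSubsets : (X : Subset n) → X ∈ allSubsets n
∈-allSubsets []            = here refl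
∈-allSubsets (outside ∷ X) = ∈-++⁺ˡ (∈-map⁺ (outside ∷_) (∈-allSubsets X))
∈-allSubsets (inside ∷ X)  = ∈-++⁺ʳ _ (∈-map⁺ (inside ∷_) (∈-allSubsets X))

unique-length-≤ : {xs ys : List A} → Unique xs → (∀ {x} → x ∈ xs → x ∈ ys) → length xs ≤ length ys
unique-length-≤ [] xs⊆ys = z≤n
unique-length-≤ {xs = x ∷ xs} (x∉xs ∷ u) xs⊆ys with ∈-∃++ (xs⊆ys (here refl))
... | as , bs , refl = begin
  suc (length xs)              ≤⟨ s≤s (unique-length-≤ u xs⊆rest) ⟩
  suc (length (as ++ bs))      ≡⟨ cong suc (length-++ as) ⟩
  suc (length as + length bs)  ≡⟨ ℕ.+-suc (length as) (length bs) ⟨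
  length as + suc (length bs)  ≡⟨ length-++ as ⟨
  length (as ++ x ∷ bs)        ∎
  where
  open ≤-Reasoning
  xs⊆rest : ∀ {z} → z ∈ xs → z ∈ as ++ bs
  xs⊆rest z∈xs with ∈-++⁻ as (xs⊆ys (there z∈xs))
  ... | inj₁ z∈as         = ∈-++⁺ˡ z∈as
  ... | inj₂ (here refl)  = contradiction refl (All.lookup x∉xs z∈xs)
  ... | inj₂ (there z∈bs) = ∈-++⁺ʳ as z∈bs

-- Repetition-freeness enters here: it keeps the number of insertions and of outputs within the size
-- of the down-closure.
length≤↓ : (ℱ : Family n) → Unique ℱ → length ℱ ≤ length (↓ ℱ)
length≤↓ ℱ u = unique-length-≤ u λ X∈ℱ →
  ∈-filter⁺ (λ Z → any? (Z ⊆?_) ℱ) (∈-allSubsets _) (lose X∈ℱ ⊆-refl)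

-- Circuit size from running time

-- A step deepens the data by at most one pair.  As the gates are output as a list, their number
-- is thus bounded by the depth of the input plus the running time.

depth : Val → ℕ
depth (num _)    = 0
depth (pair v w) = suc (depth v ⊔ depth w)

maxDepth : Vec Val k → ℕ
maxDepth []      = 0
maxDepth (v ∷ ρ) = depth v ⊔ maxDepth ρ

depth-lookup : (ρ : Vec Val k) (i : Fin k) → depth (lookup ρ i) ≤ maxDepth ρ
depth-lookup (v ∷ ρ) zero    = m≤m⊔n (depth v) (maxDepth ρ)
depth-lookup (v ∷ ρ) (suc i) = ≤-trans (depth-lookup ρ i) (m≤n⊔m (depth v) (maxDepth ρ))

depth-sucᵛ : ∀ v → depth (sucᵛ v) ≡ 0
depth-sucᵛ (num _)    = refl
depth-sucᵛ (pair _ _) = refl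

-- Common to the rules that evaluate one part and continue in another environment; `e` is the depth
-- of that environment.
sequential : ∀ {d e f} t t′ → e ≤ f + t → d ≤ e + t′ → d ≤ f + suc (t + t′)
sequential {d} {e} {f} t t′ e≤ d≤ = begin
  d                 ≤⟨ d≤ ⟩
  e + t′            ≤⟨ +-monoˡ-≤ t′ e≤ ⟩
  f + t + t′        ≡⟨ ℕ.+-assoc f t t′ ⟩
  f + (t + t′)      ≤⟨ +-monoʳ-≤ f (n≤1+n _) ⟩
  f + suc (t + t′)  ∎
  where open ≤-Reasoning

depth≤time : ∀ {T : Vec (Exp m 1) m} {ρ : Vec Val k} {e v t} → T , ρ ⊢ e ⇓ v ∣ t → depth v ≤ maxDepth ρ + t
depth≤time {ρ = ρ} (⇓var {x}) = ≤-trans (depth-lookup ρ x) (m≤m+n _ 1)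
depth≤time ⇓zero = z≤n
depth≤time (⇓suc {v = v} d) = ≤-trans (≤-reflexive (depth-sucᵛ v)) z≤n
depth≤time {ρ = ρ} (⇓pair {t = t} {t′} d d′) = ≤-trans (s≤s (⊔-lub
    (≤-trans (depth≤time d) (+-monoʳ-≤ (maxDepth ρ) (m≤m+n t t′)))
    (≤-trans (depth≤time d′) (+-monoʳ-≤ (maxDepth ρ) (m≤n+m t′ t)))))
  (≤-reflexive (sym (ℕ.+-suc (maxDepth ρ) (t + t′))))
depth≤time {ρ = ρ} (⇓case-zero {t = t} {t′} d d′) = sequential t t′ (m≤m+n (maxDepth ρ) t) (depth≤time d′)
depth≤time {ρ = ρ} (⇓case-suc {t = t} {t′} d d′) = sequential t t′ (m≤m+n (maxDepth ρ) t) (depth≤time d′)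
depth≤time {ρ = ρ} (⇓case-pair {x = x} {y} {t = t} {t′} d d′) = sequential t t′
  (⊔-lub (≤-trans (≤-trans (m≤m⊔n (depth x) (depth y)) (n≤1+n _)) (depth≤time d))
    (⊔-lub (≤-trans (≤-trans (m≤n⊔m (depth x) (depth y)) (n≤1+n _)) (depth≤time d)) (m≤m+n (maxDepth ρ) t)))
  (depth≤time d′)
depth≤time {ρ = ρ} (⇓let {t = t} {t′} d d′) =
  sequential t t′ (⊔-lub (depth≤time d) (m≤m+n (maxDepth ρ) t)) (depth≤time d′)
depth≤time (⇓call {t = t} {t′} d d′) = sequential t t′ (⊔-lub (depth≤time d) z≤n) (depth≤time d′)

depth-encodeList : {enc : A → Val} → (∀ x → depth (enc x) ≤ k) → (xs : List A) →
  depth (encodeList enc xs) ≤ length xs + k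
depth-encodeList h [] = z≤n
depth-encodeList {k = k} h (x ∷ xs) =
  s≤s (⊔-lub (≤-trans (h x) (m≤n+m k (length xs))) (depth-encodeList h xs))

depth-encodeSubset : (X : Subset n) → depth (encodeSubset X) ≤ n
depth-encodeSubset []            = z≤n
depth-encodeSubset (outside ∷ X) = s≤s (depth-encodeSubset X)
depth-encodeSubset (inside ∷ X)  = s≤s (depth-encodeSubset X)

-- The list of gates is nested to the right, so every gate adds a level.
size≤depth : {I : Set a} (encI : I → Val) (C : Gates I s) → s ≤ depth (encodeGates encI C)
size≤depth encI []      = z≤n
size≤depth encI (C ▷ g) = s≤s (≤-trans (size≤depth encI C)
  (m≤n⊔m (depth (encodeGate encI g)) (depth (encodeGates encI C))))

-- A new element of the second factor opens every row; `shifts` moves these pairs past the rows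
-- before them.
cartesianProduct-∷ʳ : (xs : List A) (y : B) (ys : List B) →
  cartesianProduct xs (y ∷ ys) ↭ map (_, y) xs ++ cartesianProduct xs ys
cartesianProduct-∷ʳ []       y ys = ↭-refl
cartesianProduct-∷ʳ (x ∷ xs) y ys = prep (x , y)
  (↭-trans (++⁺ˡ (map (x ,_) ys) (cartesianProduct-∷ʳ xs y ys)) (shifts (map (x ,_) ys) (map (_, y) xs)))

-- Here `b` bounds the lengths of both families, and `b * (N * 2) + 1` the weight of the trie after
-- `zeta`.
mainCost : ℕ → ℕ → ℕ
mainCost b N = 21 + (suc b * (N * 160 + 120) + 1 + suc b * (N * 160 + 160) +
  (5 + (suc N * ((b * (N * 2) + 1) * 100) +
    (7 + (N * 6 + 3 + 1 + suc N * ((b * (N * 2) + 1) * (N * 80 + 200)) +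
      (7 + (suc b * (N * 100 + 150) + 5)))))))

-- The total of mainCost and the depth of the input, with b ≥ 1 factored out.
polynomial : Polynomial
polynomial = 1214 ∷ 1828 ∷ 840 ∷ 160 ∷ []

mainCost≤ : ∀ b N →
  (1214 + N * (1828 + N * (840 + N * (160 + N * 0)))) * suc b ≡
  suc (suc (suc b + N + (suc b + N))) + (21 + (suc (suc b) * (N * 160 + 120) + 1 + suc (suc b) * (N * 160 + 160) +
  (5 + (suc N * ((suc b * (N * 2) + 1) * 100) +
    (7 + (N * 6 + 3 + 1 + suc N * ((suc b * (N * 2) + 1) * (N * 80 + 200)) +
      (7 + (suc (suc b) * (N * 100 + 150) + 5)))))))) +
  b * (N * N * 80 + N * 808 + 782)
mainCost≤ = solve-∀

-- Runs of the program and the circuits they emit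

module Compilation {c ℓ} (R : Ring c ℓ) {I : Set} {N : ℕ} (subsetOf : I → Subset N) where

  open Ring R
    using (Carrier; _≈_; 0#; -_; setoid; +-cong; +-congˡ; +-congʳ; +-assoc; +-identityˡ; +-identityʳ;
           -‿cong; -‿inverseʳ; +-commutativeSemigroup; +-abelianGroup)
    renaming (_+_ to _⊕_; _-_ to _⊖_; refl to ≈-refl; sym to ≈-sym; trans to ≈-trans;
              reflexive to ≈-reflexive)
  open CommutativeSemigroupProperties +-commutativeSemigroup using (interchange)
  open AbelianGroupProperties +-abelianGroup using (⁻¹-∙-comm)

  encI : I → Val
  encI i = encodeSubset (subsetOf i)

  -- The meaning of a gate for all f at once, since one circuit must serve every f.
  V : Set c
  V = (I → Carrier) → Carrier

  infixl 6 _⊕ᵛ_ _⊖ᵛ_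
  _⊕ᵛ_ _⊖ᵛ_ : V → V → V
  (v ⊕ᵛ w) f = v f ⊕ w f
  (v ⊖ᵛ w) f = v f ⊖ w f

  0ᵛ : V
  0ᵛ f = 0#

  -- Gate addresses in a growing circuit

  record Addr {s} (C : Gates I s) (x : Val) (v : V) : Set (c ⊔ˡ ℓ) where
    constructor addr
    field
      gate  : Fin s
      at    : x ≡ encodeFin gate
      value : ∀ f → lookup (values R f C) gate ≈ v f

  labelsOf : Gate I s → List I
  labelsOf (input i) = i ∷ []
  labelsOf _         = []

  infix 4 _≼[_]_
  -- An address written down earlier keeps its number and its value. `is` lists the input labels
  -- gained, latest first as in `inputLabels`.
  record _≼[_]_ {s s′} (C : Gates I s) (is : List I) (C′ : Gates I s′) : Set (c ⊔ˡ ℓ) where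
    field
      embed        : Fin s → Fin s′
      toℕ-embed    : ∀ k → toℕ (embed k) ≡ toℕ k
      lookup-embed : ∀ f k → lookup (values R f C′) (embed k) ≡ lookup (values R f C) k
      labels       : inputLabels C′ ≡ is ++ inputLabels C

  open _≼[_]_

  private
    variable
      C : Gates I s
      C′ : Gates I s′
      C″ : Gates I s″
      is js : List I

  ≼-refl : C ≼[ [] ] C
  ≼-refl .embed k          = k
  ≼-refl .toℕ-embed k      = refl
  ≼-refl .lookup-embed f k = refl
  ≼-refl .labels           = refl

  ≼-trans : C ≼[ is ] C′ → C′ ≼[ js ] C″ → C ≼[ js ++ is ] C″
  ≼-trans p q .embed k          = embed q (embed p k)
  ≼-trans p q .toℕ-embed k      = trans (toℕ-embed q _) (toℕ-embed p k)
  ≼-trans p q .lookup-embed f k = trans (lookup-embed q f _) (lookup-embed p f k)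
  ≼-trans {is = is} {js = js} p q .labels =
    trans (labels q) (trans (cong (js ++_) (labels p)) (sym (++-assoc js is _)))

  inputLabels-▷ : (C : Gates I s) (g : Gate I s) → inputLabels (C ▷ g) ≡ labelsOf g ++ inputLabels C
  inputLabels-▷ C (input i) = refl
  inputLabels-▷ C (const _) = refl
  inputLabels-▷ C (add _ _) = refl
  inputLabels-▷ C (sub _ _) = refl
  inputLabels-▷ C (mul _ _) = refl

  ≼-▷ : (C : Gates I s) (g : Gate I s) → C ≼[ labelsOf g ] C ▷ g
  ≼-▷ C g .embed              = inject₁
  ≼-▷ C g .toℕ-embed          = toℕ-inject₁
  ≼-▷ C g .lookup-embed f k   = lookup-∷ʳ-inject₁ (values R f C) _ k
  ≼-▷ C g .labels             = inputLabels-▷ C g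

  weaken : ∀ {v} → C ≼[ is ] C′ → Addr C x v → Addr C′ x v
  weaken p (addr k refl h) =
    addr (embed p k) (cong num (sym (toℕ-embed p k)))
         (λ f → ≈-trans (≈-reflexive (lookup-embed p f k)) (h f))

  state : Gates I s → Val
  state {s} C = pair (num s) (encodeGates encI C)

  record Runs {p s} (is : List I) (e : Code 1) (x : Val) (C : Gates I s)
      (Φ : ∀ {s′} → Gates I s′ → Val → Set p) (b : ℕ) : Set (c ⊔ˡ ℓ ⊔ˡ p) where
    constructor runs
    field
      {size′} : ℕ
      {grown} : Gates I size′
      ext     : C ≼[ is ] grown
      {out}   : Val
      result  : Φ grown out
      run     : (x ∷ []) ⊢ e ⇓ pair out (state grown) within b

  -- Makes the grown circuit a variable for the rest of the argument.
  continue : ∀ {p w s b} {is e x} {C : Gates I s} {Φ : ∀ {s′} → Gates I s′ → Val → Set p} {W : Set w} →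
    Runs is e x C Φ b →
    (∀ {s′} {C′ : Gates I s′} {y} → C ≼[ is ] C′ → Φ C′ y →
      (x ∷ []) ⊢ e ⇓ pair y (state C′) within b → W) → W
  continue (runs ext r run) k = k ext r run

  -- The code writes a literal 0 wherever it needs the address of a gate with value 0; this
  -- invariant justifies it.
  Zero : Gates I s → Set (c ⊔ˡ ℓ)
  Zero C = Addr C (num 0) 0ᵛ

  emit-run : ∀ {v : V} (C : Gates I s) (g : Gate I s) →
    (∀ f → gateValue R f (values R f C) g ≈ v f) →
    Runs (labelsOf g) emitCode (pair (encodeGate encI g) (state C)) C (λ C′ z → Addr C′ z v) 12
  emit-run {s = s} C g h =
    runs (≼-▷ C g)
      (addr (fromℕ s) (cong num (sym (toℕ-fromℕ s)))
        (λ f → ≈-trans (≈-reflexive (lookup-∷ʳ-fromℕ (values R f C) _)) (h f)))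
      (var′ ⇒² var′ ⇒² (var′ ,′ suc′ var′ ,′ var′ ,′ var′))

  emit-add : ∀ {v w} (C : Gates I s) → Addr C x v → Addr C y w →
    Runs [] emitCode (pair (pair (num 2) (pair x y)) (state C)) C (λ C′ z → Addr C′ z (v ⊕ᵛ w)) 12
  emit-add C (addr i refl h) (addr j refl h′) = emit-run C (add i j) (λ f → +-cong (h f) (h′ f))

  emit-sub : ∀ {v w} (C : Gates I s) → Addr C x v → Addr C y w →
    Runs [] emitCode (pair (pair (num 3) (pair x y)) (state C)) C (λ C′ z → Addr C′ z (v ⊖ᵛ w)) 12
  emit-sub C (addr i refl h) (addr j refl h′) =
    emit-run C (sub i j) (λ f → +-cong (h f) (-‿cong (h′ f)))

  add-run : ∀ {v w} (C : Gates I s) → Zero C → Addr C x v → Addr C y w →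
    Runs [] addCode (pair (state C) (pair x y)) C (λ C′ z → Addr C′ z (v ⊕ᵛ w)) 22
  add-run C _ p q with emit-add C p q
  ... | runs ext a r = runs ext a (var′ ⇒² call′ ((suc′ (suc′ zero′) ,′ var′) ,′ var′) r)

  -- Covers merging and restricting, which differ in `keep` and in the operation at leaves. `is-zip`
  -- identifies the table entry reached by the recursive call with the code under analysis.
  module Zip {A : Set a} (Q : ∀ {s} → Gates I s → Val → A → Set q)
    (Q-weaken : ∀ {s s′} {C : Gates I s} {C′ : Gates I s′} {x v} → C ≼[ [] ] C′ → Q C x v → Q C′ x v)
    (keep : Bool) (self op : Fin arity)
    (is-zip : lookup table self ≡ zipCode keep self op)
    (f : A → A → A) (cost : ℕ)
    (op-run : ∀ {s x y v w} (C : Gates I s) → Zero C → Q C x v → Q C y w →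
      Runs [] (lookup table op) (pair (state C) (pair x y)) C (λ C′ z → Q C′ z (f v w)) cost)
    where

    call-self : ∀ {x v b} → (x ∷ []) ⊢ zipCode keep self op ⇓ v within b →
             (x ∷ []) ⊢ lookup table self ⇓ v within b
    call-self {x} {v} {b} = subst (λ e → (x ∷ []) ⊢ e ⇓ v within b) (sym is-zip)

    kept : Bool → Val → Val
    kept keep x = if keep then x else num 0

    keep′ : ∀ keep {i : Fin k} {ρ} → ρ ⊢ (if keep then var i else zeroᵉ) ⇓ kept keep (lookup ρ i) within 1
    keep′ false = zero′
    keep′ true  = var′

    kept-rep : ∀ keep {Q′ : Val → A → Set q} {t : Trie A n} → TrieRep Q′ x t →
               TrieRep Q′ (kept keep x) (if keep then t else empty)
    kept-rep false r = empty
    kept-rep true  r = r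

    -- The recursion stops as soon as either side is empty, so the parts of the first trie bound the
    -- number of steps: `cost` pays for an operation at leaves, 50 for the remaining rules of a
    -- step.
    zip-run : ∀ {n s} {t u : Trie A n} (C : Gates I s) → Zero C →
      TrieRep (Q C) x t → TrieRep (Q C) y u →
      Runs [] (zipCode keep self op) (pair (state C) (pair x y)) C
        (λ C′ z → TrieRep (Q C′) z (zipTrie keep f t u)) (weight t * (cost + 50))
    zip-run C z₀ empty u = runs ≼-refl (kept-rep keep u)
      (var′ ⇒² var′ ⇒² var′ ⇒⁰ (keep′ keep ,′ var′)
        slack cost + 41 by zip-cost-empty cost)
    zip-run C z₀ t@(leaf _) empty = runs ≼-refl (kept-rep keep t)
      (var′ ⇒² var′ ⇒² var′ ⇒² var′ ⇒⁰ (keep′ keep ,′ var′)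
        slack cost + 39 by zip-cost-leaf-empty cost)
    zip-run {t = node t₁ t₂} C z₀ t@(node _ _) empty = runs ≼-refl (kept-rep keep t)
      (var′ ⇒² var′ ⇒² var′ ⇒² var′ ⇒⁰ (keep′ keep ,′ var′)
        slack cost + 39 + (weight t₁ + weight t₂) * (cost + 50)
        by zip-cost-node-empty cost (weight t₁) (weight t₂))
    zip-run C z₀ (leaf p) (leaf p′) with op-run C z₀ p p′
    ... | runs ext q r = runs ext (leaf q)
      (var′ ⇒² var′ ⇒² var′ ⇒² var′ ⇒² var′ ⇒⁰
        call′ (var′ ,′ var′ ,′ var′) r ⇒² (zero′ ,′ var′) ,′ var′
        slack 28 by zip-cost-leaf-leaf cost)
    zip-run {t = node t₁ t₂} C z₀ (node l r) (node l′ r′)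
      with zip-run C z₀ l l′
    ... | runs ext₁ p₁ run₁
      with zip-run _ (weaken ext₁ z₀) (mapTrieRep (Q-weaken ext₁) r) (mapTrieRep (Q-weaken ext₁) r′)
    ... | runs ext₂ p₂ run₂ =
      runs (≼-trans ext₁ ext₂) (node (mapTrieRep (Q-weaken ext₂) p₁) p₂)
        (var′ ⇒² var′ ⇒² var′ ⇒² var′ ⇒² var′ ⇒² var′ ⇒²
          call′ (var′ ,′ var′ ,′ var′) (call-self run₁) ⇒²
          call′ (var′ ,′ var′ ,′ var′) (call-self run₂) ⇒²
          ((var′ ,′ var′) ,′ zero′) ,′ var′
          slack cost + 17 by zip-cost-node-node cost (weight t₁) (weight t₂))

  -- Operations on tries of gate values, and their runs

  merge : Trie V n → Trie V n → Trie V n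
  merge = zipTrie true _⊕ᵛ_

  -- The coefficients of v + (x − 1) w, truncated to the length of v; u is the coefficient of w
  -- that precedes the given ones.
  combine : V → Vec V m → Vec V m → Vec V m
  combine u []       []       = []
  combine u (v ∷ vs) (w ∷ ws) = (v ⊖ᵛ w ⊕ᵛ u) ∷ combine w vs ws

  restrict : Trie (Vec V m) n → Trie (Vec V m) n → Trie (Vec V m) n
  restrict = zipTrie false (combine 0ᵛ)

  zeta : Trie V n → Trie V n
  zeta empty      = empty
  zeta (leaf v)   = leaf v
  zeta (node l r) = node (merge (zeta l) (zeta r)) (zeta r)

  evaluate : Trie V n → Trie (Vec V (suc N)) n
  evaluate empty      = empty
  evaluate (leaf v)   = leaf (v ∷ replicate N 0ᵛ)
  evaluate (node l r) = node (evaluate l) (restrict (evaluate l) (evaluate r))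

  build𝒢 : List (Subset n) → Trie V n
  build𝒢 []      = empty
  build𝒢 (Y ∷ 𝒢) = merge (singleton Y 0ᵛ) (build𝒢 𝒢)

  buildℱ : Trie V N → List I → Trie V N
  buildℱ t []       = t
  buildℱ t (i ∷ is) = merge (singleton (subsetOf i) (λ f → f i)) (buildℱ t is)

  Poly : ∀ {s} → Gates I s → Val → Vec V m → Set _
  Poly C = VecRep (Addr C)

  open Zip Addr weaken true mergeᶠ addᶠ refl _⊕ᵛ_ 22 add-run using ()
    renaming (zip-run to merge-run)

  -- The singleton is the first argument, so an insertion takes time linear in n however large the
  -- trie has become. The 72 is the cost 22 of `addᶠ` plus 50.
  insert-run : ∀ {v} {t : Trie V n} (C : Gates I s) → Zero C → (X : Subset n) →
    TrieRep (Addr C) x (singleton X v) → TrieRep (Addr C) y t →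
    Runs [] (zipCode true mergeᶠ addᶠ) (pair (state C) (pair x y)) C
      (λ C′ z → TrieRep (Addr C′) z (merge (singleton X v) t)) ((n * 2 + 1) * 72)
  insert-run {v = v} C z₀ X p q with merge-run C z₀ p q
  ... | runs ext r run = runs ext r (run upto ≤-reflexive (cong (_* 72) (weight-singleton X v)))

  build𝒢-run : (C : Gates I s) → Zero C → (𝒢 : List (Subset n)) →
    Runs [] build𝒢Code (pair (state C) (encodeList encodeSubset 𝒢)) C
      (λ C′ z → TrieRep (Addr C′) z (build𝒢 𝒢)) (suc (length 𝒢) * (n * 160 + 120))
  build𝒢-run {n = n} C z₀ [] = runs ≼-refl empty
    (var′ ⇒² var′ ⇒⁰ (zero′ ,′ var′) slack n * 160 + 113 by build𝒢-cost-[] n)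
  build𝒢-run {n = n} C z₀ (Y ∷ 𝒢) with build𝒢-run C z₀ 𝒢
  ... | runs ext₁ t₁ run₁ with singleton-run (weaken ext₁ z₀) Y
  ... | _ , t₂ , run₂ with insert-run _ (weaken ext₁ z₀) Y t₂ t₁
  ... | runs ext₃ t₃ run₃ = runs (≼-trans ext₁ ext₃) t₃
    (var′ ⇒² var′ ⇒² call′ (var′ ,′ var′) run₁ ⇒²
      call′ (var′ ,′ call′ (zero′ ,′ var′) run₂ ,′ var′) run₃
      slack 23 by build𝒢-cost-∷ (length 𝒢) n)

  buildℱ-run : (C : Gates I s) → Zero C → {t : Trie V N} → TrieRep (Addr C) x t → (is : List I) →
    Runs is buildℱCode (pair (pair x (state C)) (encodeList encI is)) C
      (λ C′ z → TrieRep (Addr C′) z (buildℱ t is)) (suc (length is) * (N * 160 + 160))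
  buildℱ-run C z₀ t [] = runs ≼-refl t (var′ ⇒² var′ ⇒⁰ var′ slack N * 160 + 155 by buildℱ-cost-[] N)
  -- The tail comes first: labels are listed latest first, so they end up in the order of the list.
  buildℱ-run C z₀ t (i ∷ is) with buildℱ-run C z₀ t is
  ... | runs ext₁ t₁ run₁ with emit-run {v = λ f → f i} _ (input i) (λ f → ≈-refl)
  ... | runs ext₂ a₂ run₂ with singleton-run a₂ (subsetOf i)
  ... | _ , t₃ , run₃ with insert-run _ (weaken ext₂ (weaken ext₁ z₀)) (subsetOf i) t₃
                             (mapTrieRep (weaken ext₂) t₁)
  ... | runs ext₄ t₄ run₄ = runs (≼-trans ext₁ (≼-trans ext₂ ext₄)) t₄
    (var′ ⇒² var′ ⇒² call′ (var′ ,′ var′) run₁ ⇒²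
      call′ ((zero′ ,′ var′) ,′ var′) run₂ ⇒²
      call′ (var′ ,′ call′ (var′ ,′ var′) run₃ ,′ var′) run₄
      slack 44 by buildℱ-cost-∷ (length is) N)

  -- The time is measured by the weight of the result, as `zeta` may enlarge the trie. The merge at
  -- a node is charged to the left subtrie of the result, so each level costs the weight of the
  -- result at most once; hence the factor `suc n`.
  zeta-run : (C : Gates I s) → Zero C → {t : Trie V n} → TrieRep (Addr C) x t →
    Runs [] zetaCode (pair (state C) x) C
      (λ C′ z → TrieRep (Addr C′) z (zeta t)) (suc n * (weight (zeta t) * 100))
  zeta-run {n = n} C z₀ empty = runs ≼-refl empty
    (var′ ⇒² var′ ⇒⁰ (var′ ,′ var′) slack 93 + n * 100 by refl)
  zeta-run C z₀ t@(leaf _) = runs ≼-refl t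
    (var′ ⇒² var′ ⇒² var′ ⇒⁰ (var′ ,′ var′) slack 91 by refl)
  zeta-run {n = suc n} C z₀ {node tl tr} (node l r) with zeta-run C z₀ l
  ... | runs ext₁ t₁ run₁ with zeta-run _ (weaken ext₁ z₀) (mapTrieRep (weaken ext₁) r)
  ... | runs ext₂ t₂ run₂ with merge-run _ (weaken ext₂ (weaken ext₁ z₀)) (mapTrieRep (weaken ext₂) t₁) t₂
  ... | runs ext₃ t₃ run₃ =
    runs (≼-trans ext₁ (≼-trans ext₂ ext₃)) (node t₃ (mapTrieRep (weaken ext₃) t₂))
      (var′ ⇒² var′ ⇒² var′ ⇒² call′ (var′ ,′ var′) run₁ ⇒² call′ (var′ ,′ var′) run₂ ⇒²
        call′ (var′ ,′ var′ ,′ var′) run₃ ⇒² (((var′ ,′ var′) ,′ zero′) ,′ var′)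
        slack n * 100 + 170 + weight (zeta tl) * 28 + weight (zeta tr) * 100
        by zeta-cost n (weight (zeta tl)) (weight (zeta tr))
        upto *-monoʳ-≤ (suc (suc n)) (*-monoˡ-≤ 100 (s≤s
          (+-monoˡ-≤ (weight (zeta tr)) (weight-zip-keep _⊕ᵛ_ (zeta tl) (zeta tr))))))

  zeros-run : Zero C → (m : ℕ) → Σ Val λ z → Poly C z (replicate m 0ᵛ) ×
    ((num m ∷ []) ⊢ zerosCode ⇓ z within (m * 6 + 3))
  zeros-run z₀ zero    = _ , [] , (var′ ⇒⁰ zero′)
  zeros-run z₀ (suc m) =
    let _ , zs , run = zeros-run z₀ m in
    _ , z₀ ∷ zs , (var′ ⇒¹ (zero′ ,′ call′ var′ run))

  combine-run : ∀ {u} {vs ws : Vec V m} (C : Gates I s) → Addr C z u → Poly C x vs → Poly C y ws →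
    Runs [] combineCode (pair (pair (state C) z) (pair x y)) C
      (λ C′ z → Poly C′ z (combine u vs ws)) (m * 80 + 12)
  combine-run C p [] [] = runs ≼-refl [] (var′ ⇒² var′ ⇒² var′ ⇒² var′ ⇒⁰ (zero′ ,′ var′) slack 1 by refl)
  combine-run {m = suc m} C p (v ∷ vs) (w ∷ ws) with emit-sub C v w
  ... | runs ext₁ a₁ run₁ with emit-add _ a₁ (weaken ext₁ p)
  ... | runs ext₂ a₂ run₂ with (let ext = ≼-trans ext₁ ext₂ in
      combine-run _ (weaken ext w) (mapVecRep (weaken ext) vs) (mapVecRep (weaken ext) ws))
  ... | runs ext₃ q₃ run₃ =
    runs (≼-trans ext₁ (≼-trans ext₂ ext₃)) (weaken ext₃ a₂ ∷ q₃)
      (var′ ⇒² var′ ⇒² var′ ⇒² var′ ⇒² var′ ⇒²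
        call′ ((suc′ (suc′ (suc′ zero′)) ,′ var′ ,′ var′) ,′ var′) run₁ ⇒²
        call′ ((suc′ (suc′ zero′) ,′ var′ ,′ var′) ,′ var′) run₂ ⇒²
        call′ ((var′ ,′ var′) ,′ var′ ,′ var′) run₃ ⇒²
        ((var′ ,′ var′) ,′ var′) slack 9 by combine-cost m)

  combine₀-run : ∀ {vs ws : Vec V m} (C : Gates I s) → Zero C → Poly C x vs → Poly C y ws →
    Runs [] combine₀Code (pair (state C) (pair x y)) C
      (λ C′ z → Poly C′ z (combine 0ᵛ vs ws)) (m * 80 + 20)
  combine₀-run {m = m} C z₀ p q with combine-run C z₀ p q
  ... | runs ext r run = runs ext r
    (var′ ⇒² call′ ((var′ ,′ zero′) ,′ var′) run slack 0 by combine₀-cost m)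

  open Zip Poly (λ ext → mapVecRep (weaken ext)) false restrictᶠ combine₀ᶠ refl
    (combine {suc N} 0ᵛ) (suc N * 80 + 20) combine₀-run using ()
    renaming (zip-run to restrict-run)

  weight-evaluate : (t : Trie V n) → weight (evaluate t) ≤ weight t
  weight-evaluate empty      = ≤-refl
  weight-evaluate (leaf v)   = ≤-refl
  weight-evaluate (node l r) = s≤s (+-mono-≤ (weight-evaluate l)
    (≤-trans (weight-zip-drop (combine 0ᵛ) (evaluate l) (evaluate r)) (weight-evaluate r)))

  -- `evaluate` never enlarges the trie, so the input weight pays level by level. The N in the last
  -- factor is for the vectors combined at each leaf.
  evaluate-run : (C : Gates I s) → Zero C → {t : Trie V n} → TrieRep (Addr C) x t →
    Poly C z (replicate N 0ᵛ) →
    Runs [] evaluateCode (pair (pair (state C) z) x) C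
      (λ C′ z → TrieRep (Poly C′) z (evaluate t)) (suc n * (weight t * (N * 80 + 200)))
  evaluate-run {n = n} C z₀ empty zs = runs ≼-refl empty
    (var′ ⇒² var′ ⇒² var′ ⇒⁰ (var′ ,′ var′)
      slack N * 80 + 191 + n * (N * 80 + 200) by evaluate-cost-empty n N)
  evaluate-run C z₀ (leaf a) zs = runs ≼-refl (leaf (a ∷ zs))
    (var′ ⇒² var′ ⇒² var′ ⇒² var′ ⇒⁰ ((zero′ ,′ var′ ,′ var′) ,′ var′)
      slack N * 80 + 185 by evaluate-cost-leaf N)
  evaluate-run {n = suc n} C z₀ {node tl tr} (node l r) zs =
    continue (evaluate-run C z₀ l zs) λ ext₁ t₁ run₁ →
    continue (evaluate-run _ (weaken ext₁ z₀) (mapTrieRep (weaken ext₁) r)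
                (mapVecRep (weaken ext₁) zs)) λ ext₂ t₂ run₂ →
    continue (restrict-run _ (weaken ext₂ (weaken ext₁ z₀))
                (mapTrieRep (mapVecRep (weaken ext₂)) t₁) t₂) λ ext₃ t₃ run₃ →
    runs (≼-trans ext₁ (≼-trans ext₂ ext₃))
      (node (mapTrieRep (mapVecRep (weaken (≼-trans ext₂ ext₃))) t₁) t₃)
      (var′ ⇒² var′ ⇒² var′ ⇒² var′ ⇒²
        call′ ((var′ ,′ var′) ,′ var′) run₁ ⇒²
        call′ ((var′ ,′ var′) ,′ var′) run₂ ⇒²
        call′ (var′ ,′ var′ ,′ var′) (run₃ upto *-monoˡ-≤ (suc N * 80 + 20 + 50) (weight-evaluate tl)) ⇒²
        (((var′ ,′ var′) ,′ zero′) ,′ var′)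
        slack n * (N * 80 + 200) + N * 160 + 364 + weight tl * 50 + weight tr * (N * 80 + 200)
        by evaluate-cost-node n N (weight tl) (weight tr))

  -- Writing the outputs

  Label : Set
  Label = Fin (suc N) × Subset N

  labelsFrom : List (Subset N) → List Label
  labelsFrom []      = []
  labelsFrom (Y ∷ 𝒢) = tabulate (_, Y) ++ labelsFrom 𝒢

  module _ (target : Label → V) where

    record Outputs {s} (labels : List Label) (C : Gates I s) (x : Val) : Set (c ⊔ˡ ℓ) where
      constructor written
      field
        entries  : List (Label × Fin s)
        encoded  : x ≡ encodeList encodeOutput entries
        labelled : map proj₁ entries ≡ labels
        correct  : All (λ (l , g) → ∀ f → lookup (values R f C) g ≈ target l f) entries
        distinct : Unique (map proj₂ entries)

    -- Earlier outputs have addresses of the form `inject₁ k`, which differ from the address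
    -- `fromℕ s` of the new gate.
    push : ∀ {labels} {C : Gates I s} {g} {l : Label} → Outputs labels C x →
      (∀ f → gateValue R f (values R f C) g ≈ target l f) →
      Outputs (l ∷ labels) (C ▷ g)
        (pair (pair (pair (encodeFin (proj₁ l)) (encodeSubset (proj₂ l))) (num s)) x)
    push {s = s} {C = C} {g} {l} (written es refl refl cs ds) h = record
      { entries  = (l , fromℕ s) ∷ map lift es
      ; encoded  = cong₂ pair (cong (pair _) (cong num (sym (toℕ-fromℕ s))))
          (sym (encodeList-cong lift (λ (_ , k) → cong (pair _) (cong num (toℕ-inject₁ k))) es))
      ; labelled = cong (l ∷_) (sym (map-∘ es))
      ; correct  = (λ f → ≈-trans (≈-reflexive (lookup-∷ʳ-fromℕ (values R f C) _)) (h f)) ∷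
          All.map⁺ (All.map (λ {(_ , k)} p f →
            ≈-trans (≈-reflexive (lookup-∷ʳ-inject₁ (values R f C) _ k)) (p f)) cs)
      ; distinct = subst (λ ks → Unique (fromℕ s ∷ ks)) (map-swap es)
          (All.map⁺ (All.universal (λ _ → fromℕ≢inject₁) (map proj₂ es)) ∷ Unique.map⁺ inject₁-injective ds) }
      where
      lift : Label × Fin s → Label × Fin (suc s)
      lift (l , k) = l , inject₁ k
      map-swap : ∀ es → map inject₁ (map proj₂ es) ≡ map proj₂ (map lift es)
      map-swap es = trans (sym (map-∘ es)) (map-∘ es)

    -- `Runs` hides the new circuit, but `push` needs it in the form `C ▷ g`.
    emit-sum : ∀ {v w} (C : Gates I s) → Addr C x v → Addr C y w →
      Σ (Gate I s) λ g → C ≼[ [] ] C ▷ g × (∀ f → gateValue R f (values R f C) g ≈ v f ⊕ w f) ×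
        ((pair (pair (num 2) (pair x y)) (state C) ∷ []) ⊢ emitCode ⇓ pair (num s) (state (C ▷ g)) within 12)
    emit-sum C (addr k refl h) (addr k′ refl h′) =
      add k k′ , ≼-▷ C (add k k′) , (λ f → +-cong (h f) (h′ f)) ,
      Runs.run (emit-run {v = λ f → gateValue R f (values R f C) (add k k′)} C (add k k′) (λ f → ≈-refl))

    -- The induction sees a suffix of the coefficient vector, starting at coefficient `j`; `ι`
    -- restores the true index of its entries.
    output-run : ∀ {labels Y j} (C : Gates I s) → Zero C → Outputs labels C x →
      {vs : Vec V m} → Poly C y vs →
      (ι : Fin m → Fin (suc N)) → (∀ k → toℕ (ι k) ≡ toℕ k + j) →
      (∀ k f → lookup vs k f ≈ target (ι k , Y) f) →
      Runs [] outputCode (pair (pair (state C) x) (pair (pair (encodeSubset Y) (num j)) y)) C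
        (Outputs (tabulate (λ k → ι k , Y) ++ labels)) (m * 70 + 11)
    output-run C z₀ os [] ι ι-val h = runs ≼-refl os
      (var′ ⇒² var′ ⇒² var′ ⇒² var′ ⇒⁰ (var′ ,′ var′) slack 0 by refl)
    output-run {m = suc m} {j = j} C z₀ os (a ∷ as) ι ι-val h
      with output-run {j = suc j} C z₀ os as (ι ∘ suc)
             (λ k → trans (ι-val (suc k)) (sym (ℕ.+-suc _ j))) (h ∘ suc)
    -- Matching on `ι-val zero` turns the counter of the program into the label that has to be
    -- written.
    ... | runs ext₁ os₁ run₁ with emit-sum _ (weaken ext₁ a) (weaken ext₁ z₀) | ι-val zero
    ... | _ , ext₂ , sum , run₂ | refl =
      runs (≼-trans ext₁ ext₂)
        (push os₁ (λ f → ≈-trans (≈-trans (sum f) (+-identityʳ _)) (h zero f)))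
        (var′ ⇒² var′ ⇒² var′ ⇒² var′ ⇒² var′ ⇒²
          call′ ((var′ ,′ var′) ,′ (var′ ,′ suc′ var′) ,′ var′) run₁ ⇒²
          call′ ((suc′ (suc′ zero′) ,′ var′ ,′ zero′) ,′ var′) run₂ ⇒²
          ((((var′ ,′ var′) ,′ var′) ,′ var′) ,′ var′)
          slack 16 by output-cost m)

    outputs-run : ∀ (C : Gates I s) → Zero C → {e : Trie (Vec V (suc N)) N} → TrieRep (Poly C) x e →
      (𝒢 : List (Subset N)) →
      (∀ {Y} → Y ∈ 𝒢 → ∃[ p ] At e Y p × (∀ k f → lookup p k f ≈ target (k , Y) f)) →
      Runs [] outputsCode (pair (pair (state C) x) (encodeList encodeSubset 𝒢)) C
        (Outputs (labelsFrom 𝒢)) (suc (length 𝒢) * (N * 100 + 150))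
    outputs-run C z₀ t [] h = runs ≼-refl (written [] refl refl [] [])
      (var′ ⇒² var′ ⇒² var′ ⇒⁰ (zero′ ,′ var′) slack N * 100 + 141 by outputs-cost-[] N)
    outputs-run C z₀ t (Y ∷ 𝒢) h with h (here refl) | outputs-run C z₀ t 𝒢 (h ∘ there)
    ... | p , at , hp | runs ext₁ os₁ run₁ with find-run t at
    ... | _ , q , run₂ with output-run {j = 0} _ (weaken ext₁ z₀) os₁ (mapVecRep (weaken ext₁) q) (λ k → k)
                             (λ k → sym (ℕ.+-identityʳ _)) hp
    ... | runs ext₃ os₃ run₃ = runs (≼-trans ext₁ ext₃) os₃
      (var′ ⇒² var′ ⇒² var′ ⇒² call′ ((var′ ,′ var′) ,′ var′) run₁ ⇒²
        call′ ((var′ ,′ var′) ,′ (var′ ,′ zero′) ,′ call′ (var′ ,′ var′) run₂) run₃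
        slack N * 10 + 35 by outputs-cost-∷ (length 𝒢) N)

  -- Leaves of the constructed tries

  ∈ᵗ-zeta : (t : Trie V n) {Y : Subset n} → Y ∈ᵗ t → Y ∈ᵗ zeta t
  ∈ᵗ-zeta (leaf _)   p             = p
  ∈ᵗ-zeta (node l r) (_ , left p)  = ∈ᵗ-left (∈ᵗ-zipˡ _⊕ᵛ_ (zeta l) (zeta r) (∈ᵗ-zeta l (_ , p)))
  ∈ᵗ-zeta (node l r) (_ , right p) = ∈ᵗ-right (∈ᵗ-zeta r (_ , p))

  -- A new leaf arises only when `merge` copies one from the right subtrie to the left, that is, by
  -- removing an element.
  ∈ᵗ-zeta⁻ : (t : Trie V n) {Y : Subset n} → Y ∈ᵗ zeta t → ∃[ X ] X ∈ᵗ t × Y ⊆ X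
  ∈ᵗ-zeta⁻ (leaf _)   p             = _ , p , ⊆-refl
  ∈ᵗ-zeta⁻ (node l r) (_ , left p) with ∈ᵗ-zip⁻ _⊕ᵛ_ (zeta l) (zeta r) (_ , p)
  ... | inj₁ q = let X , X∈l , Y⊆X = ∈ᵗ-zeta⁻ l q in outside ∷ X , ∈ᵗ-left X∈l , out⊆ Y⊆X
  ... | inj₂ q = let X , X∈r , Y⊆X = ∈ᵗ-zeta⁻ r q in inside ∷ X , ∈ᵗ-right X∈r , out⊆ Y⊆X
  ∈ᵗ-zeta⁻ (node l r) (_ , right p) =
    let X , X∈r , Y⊆X = ∈ᵗ-zeta⁻ r (_ , p) in inside ∷ X , ∈ᵗ-right X∈r , in⊆in Y⊆X

  -- At every node the right subtrie has just been merged into the left one.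
  downClosed-zeta : (t : Trie V n) → DownClosed (zeta t)
  downClosed-zeta empty      = _
  downClosed-zeta (leaf _)   = _
  downClosed-zeta (node l r) =
    ∈ᵗ-zipʳ _⊕ᵛ_ (zeta l) (zeta r) ,
    downClosed-zip _⊕ᵛ_ (zeta l) (zeta r) (downClosed-zeta l) (downClosed-zeta r) ,
    downClosed-zeta r

  ∈ᵗ-build𝒢 : (𝒢 : List (Subset n)) {Y : Subset n} → Y ∈ 𝒢 → Y ∈ᵗ build𝒢 𝒢
  ∈ᵗ-build𝒢 (Y ∷ 𝒢) (here refl) = ∈ᵗ-zipˡ _⊕ᵛ_ (singleton Y 0ᵛ) (build𝒢 𝒢) (∈ᵗ-singleton Y 0ᵛ)
  ∈ᵗ-build𝒢 (X ∷ 𝒢) (there Y∈𝒢) = ∈ᵗ-zipʳ _⊕ᵛ_ (singleton X 0ᵛ) (build𝒢 𝒢) (∈ᵗ-build𝒢 𝒢 Y∈𝒢)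

  ∈ᵗ-build𝒢⁻ : (𝒢 : List (Subset n)) {Y : Subset n} → Y ∈ᵗ build𝒢 𝒢 → Y ∈ 𝒢
  ∈ᵗ-build𝒢⁻ (X ∷ 𝒢) p with ∈ᵗ-zip⁻ _⊕ᵛ_ (singleton X 0ᵛ) (build𝒢 𝒢) p
  ... | inj₁ q = here (∈ᵗ-singleton⁻ X q)
  ... | inj₂ q = there (∈ᵗ-build𝒢⁻ 𝒢 q)

  ∈ᵗ-buildℱ : (t : Trie V N) (is : List I) {Y : Subset N} → Y ∈ᵗ t → Y ∈ᵗ buildℱ t is
  ∈ᵗ-buildℱ t []       p = p
  ∈ᵗ-buildℱ t (i ∷ is) p =
    ∈ᵗ-zipʳ _⊕ᵛ_ (singleton (subsetOf i) (λ f → f i)) (buildℱ t is) (∈ᵗ-buildℱ t is p)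

  ∈ᵗ-buildℱ⁻ : (t : Trie V N) (is : List I) {Y : Subset N} →
               Y ∈ᵗ buildℱ t is → Y ∈ map subsetOf is ⊎ Y ∈ᵗ t
  ∈ᵗ-buildℱ⁻ t []       p = inj₂ p
  ∈ᵗ-buildℱ⁻ t (i ∷ is) p
    with ∈ᵗ-zip⁻ _⊕ᵛ_ (singleton (subsetOf i) (λ f → f i)) (buildℱ t is) p
  ... | inj₁ q = inj₁ (here (∈ᵗ-singleton⁻ (subsetOf i) q))
  ... | inj₂ q = map-⊎ there (λ r → r) (∈ᵗ-buildℱ⁻ t is q)

  -- The polynomial identity, on coefficient sequences; `shift u p` is u + x p

  shift : Carrier → (ℕ → Carrier) → ℕ → Carrier
  shift u p zero    = u
  shift u p (suc j) = p j

  shift-cong : ∀ {u p q} → (∀ j → p j ≈ q j) → ∀ j → shift u p j ≈ shift u q j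
  shift-cong p≈q zero    = ≈-refl
  shift-cong p≈q (suc j) = p≈q j

  shift-⊕ : ∀ p q j → shift 0# (λ i → p i ⊕ q i) j ≈ shift 0# p j ⊕ shift 0# q j
  shift-⊕ p q zero    = ≈-sym (+-identityˡ 0#)
  shift-⊕ p q (suc j) = ≈-refl

  shift-0# : ∀ j → shift 0# (λ _ → 0#) j ≈ 0#
  shift-0# zero    = ≈-refl
  shift-0# (suc j) = ≈-refl

  shift-suc : ∀ {u} p → u ≈ p 0 → ∀ j → shift u (p ∘ suc) j ≈ p j
  shift-suc p u≈p₀ zero    = u≈p₀
  shift-suc p u≈p₀ (suc j) = ≈-refl

  cancel : ∀ u v → u ⊕ v ⊖ v ≈ u
  cancel u v = begin
    u ⊕ v ⊖ v    ≈⟨ +-assoc u v (- v) ⟩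
    u ⊕ (v ⊖ v)  ≈⟨ +-congˡ (-‿inverseʳ v) ⟩
    u ⊕ 0#       ≈⟨ +-identityʳ u ⟩
    u            ∎
    where open import Relation.Binary.Reasoning.Setoid setoid

  ⊖⊕-interchange : ∀ u u′ v v′ w w′ →
    (u ⊕ u′) ⊖ (v ⊕ v′) ⊕ (w ⊕ w′) ≈ (u ⊖ v ⊕ w) ⊕ (u′ ⊖ v′ ⊕ w′)
  ⊖⊕-interchange u u′ v v′ w w′ = begin
    (u ⊕ u′) ⊖ (v ⊕ v′) ⊕ (w ⊕ w′)          ≈⟨ +-congʳ (+-congˡ (≈-sym (⁻¹-∙-comm v v′))) ⟩
    (u ⊕ u′) ⊕ (- v ⊕ - v′) ⊕ (w ⊕ w′)      ≈⟨ +-congʳ (interchange u u′ (- v) (- v′)) ⟩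
    (u ⊖ v) ⊕ (u′ ⊖ v′) ⊕ (w ⊕ w′)          ≈⟨ interchange (u ⊖ v) (u′ ⊖ v′) w w′ ⟩
    (u ⊖ v ⊕ w) ⊕ (u′ ⊖ v′ ⊕ w′)            ∎
    where open import Relation.Binary.Reasoning.Setoid setoid

  module _ (f : I → Carrier) where

    -- The coefficients of ∑_X t(X) x^|X ∩ Y|.
    spectrum : Trie V n → Subset n → ℕ → Carrier
    spectrum empty      Y             j       = 0#
    spectrum (leaf v)   []            zero    = v f
    spectrum (leaf v)   []            (suc j) = 0#
    spectrum (node l r) (outside ∷ Y) j       = spectrum l Y j ⊕ spectrum r Y j
    spectrum (node l r) (inside ∷ Y)  j       = spectrum l Y j ⊕ shift 0# (spectrum r Y) j

    -- The coefficients of ∑_{Z ⊆ Y} (x − 1)^|Z| t(Z), if t is down-closed.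
    expansion : Trie V n → Subset n → ℕ → Carrier
    expansion empty      Y             j       = 0#
    expansion (leaf v)   []            zero    = v f
    expansion (leaf v)   []            (suc j) = 0#
    expansion (node l r) (outside ∷ Y) j       = expansion l Y j
    expansion (node l r) (inside ∷ Y)  j       =
      expansion l Y j ⊖ expansion r Y j ⊕ shift 0# (expansion r Y) j

    spectrum-merge : ∀ (t u : Trie V n) Y j → spectrum (merge t u) Y j ≈ spectrum t Y j ⊕ spectrum u Y j
    spectrum-merge empty      u            Y             j       = ≈-sym (+-identityˡ _)
    spectrum-merge (leaf v)   empty        Y             j       = ≈-sym (+-identityʳ _)
    spectrum-merge (leaf v)   (leaf w)     []            zero    = ≈-refl
    spectrum-merge (leaf v)   (leaf w)     []            (suc j) = ≈-sym (+-identityʳ _)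
    spectrum-merge (node l r) empty        Y             j       = ≈-sym (+-identityʳ _)
    spectrum-merge (node l r) (node l′ r′) (outside ∷ Y) j       =
      ≈-trans (+-cong (spectrum-merge l l′ Y j) (spectrum-merge r r′ Y j)) (interchange _ _ _ _)
    spectrum-merge (node l r) (node l′ r′) (inside ∷ Y)  j       =
      ≈-trans (+-cong (spectrum-merge l l′ Y j)
          (≈-trans (shift-cong (spectrum-merge r r′ Y) j) (shift-⊕ _ _ j)))
        (interchange _ _ _ _)

    -- A missing leaf counts as 0, so `expansion` is additive even for tries with different leaves.
    expansion-merge : ∀ (t u : Trie V n) Y j → expansion (merge t u) Y j ≈ expansion t Y j ⊕ expansion u Y j
    expansion-merge empty      u            Y             j       = ≈-sym (+-identityˡ _)
    expansion-merge (leaf v)   empty        Y             j       = ≈-sym (+-identityʳ _)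
    expansion-merge (leaf v)   (leaf w)     []            zero    = ≈-refl
    expansion-merge (leaf v)   (leaf w)     []            (suc j) = ≈-sym (+-identityʳ _)
    expansion-merge (node l r) empty        Y             j       = ≈-sym (+-identityʳ _)
    expansion-merge (node l r) (node l′ r′) (outside ∷ Y) j       = expansion-merge l l′ Y j
    expansion-merge (node l r) (node l′ r′) (inside ∷ Y)  j       =
      ≈-trans (+-cong (+-cong (expansion-merge l l′ Y j) (-‿cong (expansion-merge r r′ Y j)))
          (≈-trans (shift-cong (expansion-merge r r′ Y) j) (shift-⊕ _ _ j)))
        (⊖⊕-interchange _ _ _ _ _ _)

    -- Writing L and R for the spectra of the subtries, `zeta` yields the pair (L + R , R). Outside
    -- Y this reads L + R; inside Y it is (L + R) - R + x R = L + x R, in both cases the spectrum.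
    expansion-zeta : ∀ (t : Trie V n) Y j → expansion (zeta t) Y j ≈ spectrum t Y j
    expansion-zeta empty      Y             j       = ≈-refl
    expansion-zeta (leaf v)   []            zero    = ≈-refl
    expansion-zeta (leaf v)   []            (suc j) = ≈-refl
    expansion-zeta (node l r) (outside ∷ Y) j       =
      ≈-trans (expansion-merge (zeta l) (zeta r) Y j) (+-cong (expansion-zeta l Y j) (expansion-zeta r Y j))
    expansion-zeta (node l r) (inside ∷ Y)  j       =
      +-cong (≈-trans (≈-trans (+-congʳ (expansion-merge (zeta l) (zeta r) Y j)) (cancel _ _)) (expansion-zeta l Y j))
             (shift-cong (expansion-zeta r Y) j)

    spectrum-singleton-≡ : ∀ (X Y : Subset n) v j → ∣ X ∩ Y ∣ ≡ j → spectrum (singleton X v) Y j ≈ v f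
    spectrum-singleton-≡ []            []            v zero    eq = ≈-refl
    spectrum-singleton-≡ (outside ∷ X) (outside ∷ Y) v j       eq =
      ≈-trans (+-identityʳ _) (spectrum-singleton-≡ X Y v j eq)
    spectrum-singleton-≡ (outside ∷ X) (inside ∷ Y)  v j       eq =
      ≈-trans (≈-trans (+-congˡ (shift-0# j)) (+-identityʳ _)) (spectrum-singleton-≡ X Y v j eq)
    spectrum-singleton-≡ (inside ∷ X)  (outside ∷ Y) v j       eq =
      ≈-trans (+-identityˡ _) (spectrum-singleton-≡ X Y v j eq)
    spectrum-singleton-≡ (inside ∷ X)  (inside ∷ Y)  v (suc j) eq =
      ≈-trans (+-identityˡ _) (spectrum-singleton-≡ X Y v j (suc-injective eq))

    spectrum-singleton-≢ : ∀ (X Y : Subset n) v j → ∣ X ∩ Y ∣ ≢ j → spectrum (singleton X v) Y j ≈ 0#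
    spectrum-singleton-≢ []            []            v zero    ne = ⊥-elim (ne refl)
    spectrum-singleton-≢ []            []            v (suc j) ne = ≈-refl
    spectrum-singleton-≢ (outside ∷ X) (outside ∷ Y) v j       ne =
      ≈-trans (+-identityʳ _) (spectrum-singleton-≢ X Y v j ne)
    spectrum-singleton-≢ (outside ∷ X) (inside ∷ Y)  v j       ne =
      ≈-trans (≈-trans (+-congˡ (shift-0# j)) (+-identityʳ _)) (spectrum-singleton-≢ X Y v j ne)
    spectrum-singleton-≢ (inside ∷ X)  (outside ∷ Y) v j       ne =
      ≈-trans (+-identityˡ _) (spectrum-singleton-≢ X Y v j ne)
    spectrum-singleton-≢ (inside ∷ X)  (inside ∷ Y)  v zero    ne = +-identityˡ _
    spectrum-singleton-≢ (inside ∷ X)  (inside ∷ Y)  v (suc j) ne =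
      ≈-trans (+-identityˡ _) (spectrum-singleton-≢ X Y v j (ne ∘ cong suc))

    spectrum-build𝒢 : ∀ (𝒢 : List (Subset n)) Y j → spectrum (build𝒢 𝒢) Y j ≈ 0#
    spectrum-build𝒢 []      Y j = ≈-refl
    spectrum-build𝒢 (X ∷ 𝒢) Y j =
      ≈-trans (spectrum-merge (singleton X 0ᵛ) (build𝒢 𝒢) Y j)
        (≈-trans (+-cong vanishes (spectrum-build𝒢 𝒢 Y j)) (+-identityʳ 0#))
      where
      vanishes : spectrum (singleton X 0ᵛ) Y j ≈ 0#
      vanishes with ∣ X ∩ Y ∣ ≟ j
      ... | yes eq = spectrum-singleton-≡ X Y 0ᵛ j eq
      ... | no  ne = spectrum-singleton-≢ X Y 0ᵛ j ne

    spectrum-buildℱ : ∀ (t : Trie V N) is Y j → spectrum t Y j ≈ 0# →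
      spectrum (buildℱ t is) Y j ≈ foldr _⊕_ 0# (map f (filter (λ i → ∣ subsetOf i ∩ Y ∣ ≟ j) is))
    spectrum-buildℱ t []       Y j eq₀ = eq₀
    spectrum-buildℱ t (i ∷ is) Y j eq₀ =
      ≈-trans (spectrum-merge (singleton (subsetOf i) (λ f → f i)) (buildℱ t is) Y j) step
      where
      meets? = λ i → ∣ subsetOf i ∩ Y ∣ ≟ j
      step : spectrum (singleton (subsetOf i) (λ f → f i)) Y j ⊕ spectrum (buildℱ t is) Y j ≈
             foldr _⊕_ 0# (map f (filter meets? (i ∷ is)))
      step with ∣ subsetOf i ∩ Y ∣ ≟ j
      ... | yes eq rewrite filter-accept meets? {xs = is} eq =
        +-cong (spectrum-singleton-≡ (subsetOf i) Y _ j eq) (spectrum-buildℱ t is Y j eq₀)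
      ... | no ne rewrite filter-reject meets? {xs = is} ne =
        ≈-trans (+-cong (spectrum-singleton-≢ (subsetOf i) Y _ j ne) (spectrum-buildℱ t is Y j eq₀))
                (+-identityˡ _)

    -- Coefficient j depends only on coefficients j and j - 1 of the operands, so truncation does no
    -- harm. The preceding coefficient `u` is general because the induction replaces it by the head
    -- `w`.
    lookup-combine : ∀ u (vs ws : Vec V m) (p q : ℕ → Carrier) →
      (∀ j → lookup vs j f ≈ p (toℕ j)) → (∀ j → lookup ws j f ≈ q (toℕ j)) →
      ∀ j → lookup (combine u vs ws) j f ≈ p (toℕ j) ⊖ q (toℕ j) ⊕ shift (u f) q (toℕ j)
    lookup-combine u (v ∷ vs) (w ∷ ws) p q hv hw zero    = +-congʳ (+-cong (hv zero) (-‿cong (hw zero)))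
    lookup-combine u (v ∷ vs) (w ∷ ws) p q hv hw (suc j) =
      ≈-trans (lookup-combine w vs ws (p ∘ suc) (q ∘ suc) (hv ∘ suc) (hw ∘ suc) j)
              (+-congˡ (shift-suc q (hw zero) (toℕ j)))

  evaluate-correct : ∀ (t : Trie V n) {Y} → DownClosed t → Y ∈ᵗ t →
    ∃[ p ] At (evaluate t) Y p × (∀ j f → lookup p j f ≈ expansion f t Y (toℕ j))
  evaluate-correct (leaf v) _ (_ , here) = _ , here ,
    λ { zero f → ≈-refl ; (suc j) f → ≈-reflexive (cong (λ w → w f) (lookup-replicate j 0ᵛ)) }
  evaluate-correct (node l r) (_ , cl , _) (_ , left at) =
    let p , at′ , h = evaluate-correct l cl (_ , at) in p , left at′ , h
  evaluate-correct (node l r) {inside ∷ Y} (r⊆l , cl , cr) (_ , right at) =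
    -- Down-closure provides the counterpart in `l`; without it the intersection in `restrict` would
    -- lose this leaf.
    let p , atₗ , hₗ = evaluate-correct l cl (r⊆l (_ , at))
        q , atᵣ , hᵣ = evaluate-correct r cr (_ , at)
    in _ , right (At-zip false (combine 0ᵛ) atₗ atᵣ) ,
       λ j f → lookup-combine f 0ᵛ p q (expansion f l Y) (expansion f r Y)
         (λ i → hₗ i f) (λ i → hᵣ i f) j

  -- The program writes the outputs set by set, whereas the product runs over j first.
  labelsFrom-↭ : (𝒢 : List (Subset N)) → labelsFrom 𝒢 ↭ cartesianProduct (allFin (suc N)) 𝒢
  labelsFrom-↭ []      = ↭-reflexive (sym (cartesianProductWith-zeroʳ _,_ (allFin (suc N))))
  labelsFrom-↭ (Y ∷ 𝒢) = ↭-trans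
    (↭-reflexive (cong (_++ labelsFrom 𝒢) (sym (map-tabulate (λ j → j) (_, Y)))))
    (↭-trans (++⁺ˡ (map (_, Y) (allFin (suc N))) (labelsFrom-↭ 𝒢))
      (↭-sym (cartesianProduct-∷ʳ (allFin (suc N)) Y 𝒢)))

  -- From the tries to the complete run

  pruned-build𝒢 : (𝒢 : List (Subset n)) → Pruned (build𝒢 𝒢)
  pruned-build𝒢 []      = _
  pruned-build𝒢 (Y ∷ 𝒢) = pruned-zip _⊕ᵛ_ (singleton Y 0ᵛ) (build𝒢 𝒢) (pruned-singleton Y 0ᵛ) (pruned-build𝒢 𝒢)

  pruned-buildℱ : (t : Trie V N) (is : List I) → Pruned t → Pruned (buildℱ t is)
  pruned-buildℱ t []       pt = pt
  pruned-buildℱ t (i ∷ is) pt = pruned-zip _⊕ᵛ_ (singleton (subsetOf i) (λ f → f i)) (buildℱ t is)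
    (pruned-singleton (subsetOf i) (λ f → f i)) (pruned-buildℱ t is pt)

  pruned-zeta : (t : Trie V n) → Pruned t → Pruned (zeta t)
  pruned-zeta empty      _                    = _
  pruned-zeta (leaf _)   _                    = _
  pruned-zeta (node l r) ((_ , p) , pl , pr) =
    (_ , ∈ᵗ-zeta (node l r) p) ,
    pruned-zip _⊕ᵛ_ (zeta l) (zeta r) (pruned-zeta l pl) (pruned-zeta r pr) , pruned-zeta r pr

  transformTrie : List I → List (Subset N) → Trie V N
  transformTrie is 𝒢 = zeta (buildℱ (build𝒢 𝒢) is)

  pruned-transformTrie : ∀ is 𝒢 → Pruned (transformTrie is 𝒢)
  pruned-transformTrie is 𝒢 = pruned-zeta (buildℱ (build𝒢 𝒢) is)
    (pruned-buildℱ (build𝒢 𝒢) is (pruned-build𝒢 𝒢))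

  target : List I → Label → V
  target is (j , Y) f = foldr _⊕_ 0# (map f (filter (λ i → ∣ subsetOf i ∩ Y ∣ ≟ toℕ j) is))

  transform-correct : ∀ is 𝒢 {Y} → Y ∈ 𝒢 →
    ∃[ p ] At (evaluate (transformTrie is 𝒢)) Y p ×
      (∀ j f → lookup p j f ≈ target is (j , Y) f)
  transform-correct is 𝒢 {Y} Y∈𝒢 =
    let t₀ = build𝒢 𝒢
        t = buildℱ t₀ is
        p , at , h = evaluate-correct (zeta t) (downClosed-zeta t)
                       (∈ᵗ-zeta t (∈ᵗ-buildℱ t₀ is (∈ᵗ-build𝒢 𝒢 Y∈𝒢)))
    in p , at , λ j f → ≈-trans (h j f) (≈-trans (expansion-zeta f t Y (toℕ j))
         (spectrum-buildℱ f t₀ is Y (toℕ j) (spectrum-build𝒢 f 𝒢 Y (toℕ j))))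

  record Compiled (is : List I) (𝒢 : List (Subset N)) (b : ℕ) : Set (c ⊔ˡ ℓ) where
    field
      {size′} : ℕ
      circuit : Gates I size′
      labels  : inputLabels circuit ≡ is
      {out}   : Val
      emitted : Outputs (target is) (labelsFrom 𝒢) circuit out
      run     : (pair (num N) (pair (encodeList encI is) (encodeList encodeSubset 𝒢)) ∷ [])
                  ⊢ mainCode ⇓ pair (encodeGates encI circuit) out within mainCost b N

  main-run : ∀ is 𝒢 b → length is ≤ b → length 𝒢 ≤ b → weight (transformTrie is 𝒢) ≤ b * (N * 2) + 1 →
    Compiled is 𝒢 b
  main-run is 𝒢 b is≤b 𝒢≤b t≤b =
    continue (build𝒢-run base z₀ 𝒢) λ ext₁ t₁ run₁ →
    continue (buildℱ-run _ (weaken ext₁ z₀) t₁ is) λ ext₂ t₂ run₂ →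
    continue (zeta-run _ (weaken ext₂ (weaken ext₁ z₀)) t₂) λ ext₃ t₃ run₃ →
    let ext₁₋₃ = ≼-trans (≼-trans ext₁ ext₂) ext₃
        z₃ = weaken ext₁₋₃ z₀
        _ , zs , run₄ = zeros-run z₃ N
    in
    continue (evaluate-run _ z₃ t₃ zs) λ ext₅ t₅ run₅ →
    continue (outputs-run (target is) _ (weaken ext₅ z₃) t₅ 𝒢 (transform-correct is 𝒢)) λ ext₆ os run₆ →
    record
      { labels  = trans (_≼[_]_.labels (≼-trans (≼-trans ext₁₋₃ ext₅) ext₆))
                        (trans (++-identityʳ _) (++-identityʳ is))
      ; emitted = os
      ; run     = var′ ⇒² var′ ⇒²
          call′ (call′ ((suc′ zero′ ,′ (suc′ zero′ ,′ zero′ ,′ zero′) ,′ zero′) ,′ var′)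
                   (run₁ upto *-monoˡ-≤ (N * 160 + 120) (s≤s 𝒢≤b)) ,′ var′)
            (run₂ upto *-monoˡ-≤ (N * 160 + 160) (s≤s is≤b)) ⇒²
          call′ (var′ ,′ var′) (run₃ upto *-monoʳ-≤ (suc N) (*-monoˡ-≤ 100 t≤b)) ⇒²
          call′ ((var′ ,′ call′ var′ run₄) ,′ var′)
            (run₅ upto *-monoʳ-≤ (suc N) (*-monoˡ-≤ (N * 80 + 200) t≤b)) ⇒²
          call′ ((var′ ,′ var′) ,′ var′) (run₆ upto *-monoˡ-≤ (N * 100 + 150) (s≤s 𝒢≤b)) ⇒²
          var′ ⇒² (var′ ,′ var′)
      }
    where
    base : Gates I 1
    base = [] ▷ const (+ 0)
    z₀ : Zero base
    z₀ = addr zero refl (λ _ → ≈-refl)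

-- Bounds for a given instance

members-proj₁ : (ℱ : Family n) → map proj₁ (members ℱ) ≡ ℱ
members-proj₁ ℱ = trans (map-mapWith∈ ℱ _ proj₁) (mapWith∈-id ℱ)

total≤ : ∀ b N → 1 ≤ b → suc (suc (b + N + (b + N))) + mainCost b N ≤ evalPoly polynomial N * b
total≤ (suc b) N _ = subst (suc (suc (suc b + N + (suc b + N))) + mainCost (suc b) N ≤_)
  (sym (mainCost≤ b N)) (m≤m+n _ _)

depth-encodeInstance : (ℱ 𝒢 : Family n) → ∀ b → length ℱ ≤ b → length 𝒢 ≤ b →
  depth (encodeInstance ℱ 𝒢) ≤ suc (suc (b + n + (b + n)))
depth-encodeInstance {n} ℱ 𝒢 b ℱ≤b 𝒢≤b = s≤s (s≤s (⊔-lub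
  (≤-trans (family≤ ℱ ℱ≤b) (m≤m+n (b + n) (b + n)))
  (≤-trans (family≤ 𝒢 𝒢≤b) (m≤n+m (b + n) (b + n)))))
  where
  family≤ : ∀ ℋ → length ℋ ≤ b → depth (encodeList encodeSubset ℋ) ≤ b + n
  family≤ ℋ ℋ≤b = ≤-trans (depth-encodeList depth-encodeSubset ℋ) (+-monoˡ-≤ n ℋ≤b)

-- Each leaf lies below a member of ℱ or of 𝒢, so the leaves are counted by the union of the two
-- down-closures.
leaves-transformTrie : ∀ {c ℓ} (R : Ring c ℓ) (ℱ 𝒢 : Family n) →
  leaves (Compilation.transformTrie R {Member ℱ} proj₁ (members ℱ) 𝒢) ≤ length (↓ ℱ) + length (↓ 𝒢)
leaves-transformTrie R ℱ 𝒢 = ≤-trans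
  (leaves≤filter (λ Z → any? (Z ⊆?_) ℱ ⊎-dec any? (Z ⊆?_) 𝒢) _ below)
  (length-filter-⊎ (λ Z → any? (Z ⊆?_) ℱ) (λ Z → any? (Z ⊆?_) 𝒢) (allSubsets _))
  where
  open Compilation R {Member ℱ} proj₁
  below : ∀ {Y} → Y ∈ᵗ Compilation.transformTrie R proj₁ (members ℱ) 𝒢 → Any (Y ⊆_) ℱ ⊎ Any (Y ⊆_) 𝒢
  below {Y} p with ∈ᵗ-zeta⁻ (buildℱ (build𝒢 𝒢) (members ℱ)) p
  ... | X , X∈t , Y⊆X with ∈ᵗ-buildℱ⁻ (build𝒢 𝒢) (members ℱ) X∈t
  ... | inj₁ X∈ℱ = inj₁ (lose {P = Y ⊆_} (subst (X ∈_) (members-proj₁ ℱ) X∈ℱ) Y⊆X)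
  ... | inj₂ X∈𝒢 = inj₂ (lose {P = Y ⊆_} (∈ᵗ-build𝒢⁻ 𝒢 X∈𝒢) Y⊆X)

Solution : ∀ {c ℓ} → Ring c ℓ → (n : ℕ) → Family n → Family n → Set (c ⊔ˡ ℓ)
Solution R n ℱ 𝒢 =
  Σ[ C ∈ Circuit (Member ℱ) (Fin (suc n) × Subset n) ] Σ[ t ∈ ℕ ]
  ( program ⟨ encodeInstance ℱ 𝒢 ⟩⇓ encodeCircuit C inTime t
  × t ≤ bound polynomial ℱ 𝒢
  × size C ≤ bound polynomial ℱ 𝒢
  × ComputesIntersectionTransform R ℱ 𝒢 C )

module _ {c ℓ} (R : Ring c ℓ) (ℱ 𝒢 : Family n) (ℱ! : Unique ℱ) (𝒢! : Unique 𝒢) where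

  open Compilation R {Member ℱ} {n} proj₁
  open ≤-Reasoning

  private
    D : ℕ
    D = 1 ⊔ (length (↓ ℱ) + length (↓ 𝒢))

    ↓≤D : length (↓ ℱ) + length (↓ 𝒢) ≤ D
    ↓≤D = m≤n⊔m 1 _

    ℱ≤D : length ℱ ≤ D
    ℱ≤D = ≤-trans (length≤↓ ℱ ℱ!) (≤-trans (m≤m+n _ _) ↓≤D)

    𝒢≤D : length 𝒢 ≤ D
    𝒢≤D = ≤-trans (length≤↓ 𝒢 𝒢!) (≤-trans (m≤n+m _ (length (↓ ℱ))) ↓≤D)

    members≤D : length (members ℱ) ≤ D
    members≤D = begin
      length (members ℱ)              ≡⟨ length-map proj₁ (members ℱ) ⟨
      length (map proj₁ (members ℱ))  ≡⟨ cong length (members-proj₁ ℱ) ⟩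
      length ℱ                        ≤⟨ ℱ≤D ⟩
      D                               ∎

    weight≤D : weight (transformTrie (members ℱ) 𝒢) ≤ D * (n * 2) + 1
    weight≤D = begin
      weight (transformTrie (members ℱ) 𝒢)
        ≤⟨ weight≤leaves _ (pruned-transformTrie (members ℱ) 𝒢) ⟩
      leaves (transformTrie (members ℱ) 𝒢) * (n * 2) + 1
        ≤⟨ +-monoˡ-≤ 1 (*-monoˡ-≤ (n * 2) (≤-trans (leaves-transformTrie R ℱ 𝒢) ↓≤D)) ⟩
      D * (n * 2) + 1  ∎

    encode-members : encodeList encI (members ℱ) ≡ encodeList encodeSubset ℱ
    encode-members = trans (sym (encodeList-cong proj₁ (λ _ → refl) (members ℱ)))
                           (cong (encodeList encodeSubset) (members-proj₁ ℱ))

    solution-from : (C : Circuit (Member ℱ) (Fin (suc n) × Subset n)) →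
      inputLabels (gates C) ≡ members ℱ →
      map proj₁ (outputs C) ≡ labelsFrom 𝒢 →
      Unique (map proj₂ (outputs C)) →
      All (λ o → ∀ f → CorrectOutput R ℱ C f o) (outputs C) →
      (encodeInstance ℱ 𝒢 ∷ []) ⊢ mainCode ⇓ encodeCircuit C within mainCost D n →
      Solution R n ℱ 𝒢
    solution-from C labels labelled distinct correct (within {t} run t≤) =
      C , t , run , ≤-trans (m≤n+m t _) total , size≤ , record
        { oneInputPerMember = ↭-reflexive labels
        ; oneOutputPerPair  = ↭-trans (↭-reflexive labelled) (labelsFrom-↭ 𝒢)
        ; distinctOutputs   = distinct
        ; correct           = λ f → All.map (λ h → h f) correct
        }
      where
      total : suc (suc (D + n + (D + n))) + t ≤ bound polynomial ℱ 𝒢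
      total = ≤-trans (+-monoʳ-≤ (suc (suc (D + n + (D + n)))) t≤)
                      (total≤ D n (m≤m⊔n 1 (length (↓ ℱ) + length (↓ 𝒢))))

      size≤ : size C ≤ bound polynomial ℱ 𝒢
      size≤ = begin
        size C                                   ≤⟨ size≤depth encI (gates C) ⟩
        depth (encodeGates encI (gates C))       ≤⟨ m≤n⇒m≤1+n (m≤m⊔n _ _) ⟩
        depth (encodeCircuit C)                  ≤⟨ depth≤time run ⟩
        (depth (encodeInstance ℱ 𝒢) ⊔ 0) + t
          ≤⟨ +-monoˡ-≤ t (⊔-lub (depth-encodeInstance ℱ 𝒢 D ℱ≤D 𝒢≤D) z≤n) ⟩
        suc (suc (D + n + (D + n))) + t          ≤⟨ total ⟩
        bound polynomial ℱ 𝒢                     ∎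

    solution-of : Compiled (members ℱ) 𝒢 D → Solution R n ℱ 𝒢
    solution-of compiled = solution-from
      (record { gates = circuit ; outputs = entries }) labels labelled distinct correct
      -- A member is encoded as its bare subset, so the input of this run is the encoded instance
      -- itself.
      (subst₂ (λ v w → (pair (num n) (pair v (encodeList encodeSubset 𝒢)) ∷ []) ⊢ mainCode
                         ⇓ pair (encodeGates encI circuit) w within mainCost D n)
        encode-members encoded run)
      where
      open Compiled compiled
      open Outputs emitted

  solution : Solution R n ℱ 𝒢
  solution = solution-of (main-run (members ℱ) 𝒢 D members≤D 𝒢≤D weight≤D)

theorem1 : ∀ {c ℓ} (R : Ring c ℓ) →
    Σ[ P ∈ Program ] Σ[ p ∈ Polynomial ]
    ((n : ℕ) (ℱ 𝒢 : Family n) → Unique ℱ → Unique 𝒢 →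
    Σ[ C ∈ Circuit (Member ℱ) (Fin (suc n) × Subset n) ] Σ[ t ∈ ℕ ]
    ( P ⟨ encodeInstance ℱ 𝒢 ⟩⇓ encodeCircuit C inTime t
    × t ≤ bound p ℱ 𝒢
    × size C ≤ bound p ℱ 𝒢
    × ComputesIntersectionTransform R ℱ 𝒢 C ))
theorem1 R = program , polynomial , λ n ℱ 𝒢 ℱ! 𝒢! → solution R ℱ 𝒢 ℱ! 𝒢!
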